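{- For every $n\ge1$, $E_{\min}(\omega^n+1)\ \not\le_c\ \cong_{\mathcal{CM}_n}$.
   Context: $W_e$ denotes the $e$-th c.e. set. $\mathcal{CM}$ is the variety of commutative monoids. For $n\ge1$, $X_n=\{x_0,\dots,x_{n-1}\}$; fix a computable bijective coding of pairs of terms over $X_n$ by natural numbers. $\mathcal{CM}_n[e]$ is the term algebra over $X_n$ modulo the smallest congruence containing the pairs coded in $W_e$ and all instances of the commutative monoid laws; $e\cong_{\mathcal{CM}_n}i$ iff $\mathcal{CM}_n[e]\cong\mathcal{CM}_n[i]$. For an ordinal $\alpha\le\omega^\omega$, fix a computable bijection $h$ from the ordinals $<\alpha$ (Cantor normal forms coded as finite tuples of naturals) onto $\mathbb N$, let $n\le_\alpha m$ iff $h^{ -1}(n)\le h^{ -1}(m)$, and let $e\,E_{\min}(\alpha)\,i$ iff $W_e,W_i$ are both empty or have the same $\le_\alpha$-least element. $E\le_c F$ means there is a total computable $h$ with $x\,E\,y\iff h(x)\,F\,h(y)$. -}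

module Defs where

open import Level using (0ℓ)
open import Data.Nat using (ℕ; zero; suc; _+_; _∸_; _<_; _≤_; _<?_; _≡ᵇ_)
open import Data.Fin using (Fin; fromℕ<)
open import Data.Vec using (Vec; []; _∷_)
open import Data.Product using (Σ; Σ-syntax; ∃; _×_; _,_; proj₁; proj₂)
open import Data.Sum using (_⊎_)
open import Data.Bool using (true; false)
open import Relation.Nullary using (¬_; yes; no)
open import Relation.Binary.PropositionalEquality using (_≡_)
open import Function.Bundles using (_⇔_)
open import Algebra.Bundles using (CommutativeMonoid)
open import Algebra.Structures using (IsCommutativeMonoid)
open import Algebra.Morphism.Structures using (module MonoidMorphisms)

-- Cantor-style pairing: unpair : ℕ → ℕ × ℕ enumerates ℕ × ℕ along
-- diagonals, a computable bijection.

unpair : ℕ → ℕ × ℕ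
unpair zero = (0 , 0)
unpair (suc n) with unpair n
... | (x , zero)  = (0 , suc x)
... | (x , suc y) = (suc x , y)

data PR : ℕ → Set where
  zer  : ∀ {k} → PR k
  succ : PR 1
  proj : ∀ {k} → Fin k → PR k
  comp : ∀ {k m} → PR m → Vec (PR k) m → PR k
  prec : ∀ {k} → PR k → PR (suc (suc k)) → PR (suc k)
  mu   : ∀ {k} → PR (suc k) → PR k

mutual
  data Eval : ∀ {k} → PR k → Vec ℕ k → ℕ → Set where
    ev-zer  : ∀ {k} {xs : Vec ℕ k} → Eval zer xs 0
    ev-succ : ∀ {x} → Eval succ (x ∷ []) (suc x)
    ev-proj : ∀ {k} {i : Fin k} {xs : Vec ℕ k} → Eval (proj i) xs (Data.Vec.lookup xs i)
    ev-comp : ∀ {k m} {f : PR m} {gs : Vec (PR k) m} {xs : Vec ℕ k} {ys : Vec ℕ m} {y} →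
              EvalVec gs xs ys → Eval f ys y → Eval (comp f gs) xs y
    ev-prec0 : ∀ {k} {f : PR k} {g : PR (suc (suc k))} {xs : Vec ℕ k} {y} →
               Eval f xs y → Eval (prec f g) (0 ∷ xs) y
    ev-precS : ∀ {k} {f : PR k} {g : PR (suc (suc k))} {xs : Vec ℕ k} {n z y} →
               Eval (prec f g) (n ∷ xs) z → Eval g (n ∷ z ∷ xs) y →
               Eval (prec f g) (suc n ∷ xs) y
    ev-mu   : ∀ {k} {f : PR (suc k)} {xs : Vec ℕ k} {y} →
              MuFrom f xs 0 y → Eval (mu f) xs y

  data EvalVec {k} : ∀ {m} → Vec (PR k) m → Vec ℕ k → Vec ℕ m → Set where
    []  : ∀ {xs} → EvalVec [] xs []
    _∷_ : ∀ {m} {g : PR k} {gs : Vec (PR k) m} {xs y ys} →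
          Eval g xs y → EvalVec gs xs ys → EvalVec (g ∷ gs) xs (y ∷ ys)

  data MuFrom {k} (f : PR (suc k)) (xs : Vec ℕ k) : ℕ → ℕ → Set where
    mu-here : ∀ {z} → Eval f (z ∷ xs) 0 → MuFrom f xs z z
    mu-next : ∀ {z v y} → Eval f (z ∷ xs) (suc v) → MuFrom f xs (suc z) y →
              MuFrom f xs z y

toFin : (k : ℕ) → ℕ → Fin (suc k)
toFin zero    _       = Fin.zero
toFin (suc k) zero    = Fin.zero
toFin (suc k) (suc r) = Fin.suc (toFin k r)

mutual
  decodePR : ℕ → (k : ℕ) → ℕ → PR k
  decodePR zero k e = zer
  decodePR (suc fuel) k e = go k (proj₁ (unpair e)) (proj₂ (unpair e))
    where
    go : (k : ℕ) → ℕ → ℕ → PR k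
    go k zero r = zer
    go (suc zero) (suc zero) r = succ
    go k (suc zero) r = zer
    go zero (suc (suc zero)) r = zer
    go (suc k) (suc (suc zero)) r = proj (toFin k r)
    go k (suc (suc (suc zero))) r =
      comp (decodePR fuel (proj₁ (unpair r)) (proj₁ (unpair (proj₂ (unpair r)))))
           (decodeVecPR fuel k (proj₁ (unpair r)) (proj₂ (unpair (proj₂ (unpair r)))))
    go zero (suc (suc (suc (suc zero)))) r = zer
    go (suc k) (suc (suc (suc (suc zero)))) r =
      prec (decodePR fuel k (proj₁ (unpair r)))
           (decodePR fuel (suc (suc k)) (proj₂ (unpair r)))
    go k (suc (suc (suc (suc (suc zero))))) r = mu (decodePR fuel (suc k) r)
    go k (suc (suc (suc (suc (suc (suc _)))))) r = zer

  decodeVecPR : ℕ → (k m : ℕ) → ℕ → Vec (PR k) m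
  decodeVecPR fuel k zero    b = []
  decodeVecPR fuel k (suc m) b =
    decodePR fuel k (proj₁ (unpair b)) ∷ decodeVecPR fuel k m (proj₂ (unpair b))

φ : ℕ → PR 1
φ e = decodePR (suc e) 1 e

W : ℕ → ℕ → Set
W e x = ∃ λ y → Eval (φ e) (x ∷ []) y

Computable : (ℕ → ℕ) → Set
Computable h = Σ (PR 1) λ c → ∀ x → Eval c (x ∷ []) (h x)

_≤c_ : (ℕ → ℕ → Set) → (ℕ → ℕ → Set) → Set
E ≤c F = Σ (ℕ → ℕ) λ h → Computable h × (∀ x y → E x y ⇔ F (h x) (h y))

-- Ordinals < ω^n + 1 in Cantor normal form:
--   top      = ω^n
--   fin v    = ω^(n-1)·v₀ + … + ω^0·v_(n-1)   (v = v₀ ∷ … ∷ v_(n-1))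

data Ord (n : ℕ) : Set where
  top : Ord n
  fin : Vec ℕ n → Ord n

data _≤lex_ : ∀ {n} → Vec ℕ n → Vec ℕ n → Set where
  lex-[] : [] ≤lex []
  lex-<  : ∀ {n x y} {v w : Vec ℕ n} → x < y → (x ∷ v) ≤lex (y ∷ w)
  lex-≡  : ∀ {n x} {v w : Vec ℕ n} → v ≤lex w → (x ∷ v) ≤lex (x ∷ w)

data _≤O_ {n : ℕ} : Ord n → Ord n → Set where
  top≤top : top ≤O top
  fin≤top : ∀ {v} → fin v ≤O top
  fin≤fin : ∀ {v w} → v ≤lex w → fin v ≤O fin w

decodeVec : (n : ℕ) → ℕ → Vec ℕ (suc n)
decodeVec zero    k = k ∷ []
decodeVec (suc n) k = proj₁ (unpair k) ∷ decodeVec n (proj₂ (unpair k))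

-- h⁻¹ : ℕ → Ord (suc m), inverse of the fixed computable bijection
-- h : ordinals < ω^(suc m) + 1 → ℕ
decodeOrd : (m : ℕ) → ℕ → Ord (suc m)
decodeOrd m zero    = top
decodeOrd m (suc k) = fin (decodeVec m k)

_≤[_]_ : ℕ → ℕ → ℕ → Set
x ≤[ m ] y = decodeOrd m x ≤O decodeOrd m y

IsLeast : ℕ → ℕ → ℕ → Set
IsLeast m e y = W e y × (∀ z → W e z → y ≤[ m ] z)

Empty : ℕ → Set
Empty e = ∀ x → ¬ W e x

-- E_min(ω^(suc m) + 1)
Emin : ℕ → ℕ → ℕ → Set
Emin m e i = (Empty e × Empty i) ⊎ (Σ ℕ λ y → IsLeast m e y × IsLeast m i y)

data Term (n : ℕ) : Set where
  var : Fin n → Term n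
  ε   : Term n
  _·_ : Term n → Term n → Term n

-- bijective coding ℕ → Term n (with fuel; fuel suc k suffices for k):
-- k < n ↦ x_k ; k = n ↦ ε ; n+1+⟨a,b⟩ ↦ t_a · t_b
decodeTerm : (n : ℕ) → ℕ → ℕ → Term n
decodeTerm n zero k = ε
decodeTerm n (suc fuel) k with k <? n
... | yes k<n = var (fromℕ< k<n)
... | no _ with k ≡ᵇ n
...   | true  = ε
...   | false = decodeTerm n fuel (proj₁ (unpair (k ∸ suc n)))
                   · decodeTerm n fuel (proj₂ (unpair (k ∸ suc n)))

termOf : (n : ℕ) → ℕ → Term n
termOf n k = decodeTerm n (suc k) k

pairOf : (n : ℕ) → ℕ → Term n × Term n
pairOf n p = termOf n (proj₁ (unpair p)) , termOf n (proj₂ (unpair p))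

Gen : (n e : ℕ) → Term n → Term n → Set
Gen n e s t = Σ ℕ λ p → W e p × pairOf n p ≡ (s , t)

data Cong {n : ℕ} (R : Term n → Term n → Set) : Term n → Term n → Set where
  gen   : ∀ {s t} → R s t → Cong R s t
  refl  : ∀ {s} → Cong R s s
  sym   : ∀ {s t} → Cong R s t → Cong R t s
  trans : ∀ {s t u} → Cong R s t → Cong R t u → Cong R s u
  ·-cong : ∀ {s s' t t'} → Cong R s s' → Cong R t t' → Cong R (s · t) (s' · t')
  assoc : ∀ {s t u} → Cong R ((s · t) · u) (s · (t · u))
  comm  : ∀ {s t} → Cong R (s · t) (t · s)
  idˡ   : ∀ {s} → Cong R (ε · s) s
  idʳ   : ∀ {s} → Cong R (s · ε) s

CM : (n e : ℕ) → CommutativeMonoid 0ℓ 0ℓ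
CM n e = record
  { Carrier = Term n
  ; _≈_ = Cong (Gen n e)
  ; _∙_ = _·_
  ; ε = ε
  ; isCommutativeMonoid = record
    { isMonoid = record
      { isSemigroup = record
        { isMagma = record
          { isEquivalence = record { refl = refl ; sym = sym ; trans = trans }
          ; ∙-cong = ·-cong }
        ; assoc = λ _ _ _ → assoc }
      ; identity = (λ _ → idˡ) , (λ _ → idʳ) }
    ; comm = λ _ _ → comm }
  }

_≅M_ : CommutativeMonoid 0ℓ 0ℓ → CommutativeMonoid 0ℓ 0ℓ → Set
A ≅M B = Σ (CommutativeMonoid.Carrier A → CommutativeMonoid.Carrier B)
  (MonoidMorphisms.IsMonoidIsomorphism
     (CommutativeMonoid.rawMonoid A) (CommutativeMonoid.rawMonoid B))

≅CM : ℕ → ℕ → ℕ → Set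
≅CM n e i = CM n e ≅M CM n i

{-# OPTIONS --safe #-}
module Submission where

-- Let h be a reduction.  If W e′ arises from W e by adding a new least element b, then CM (h e′)
-- is a proper quotient of CM (h e).  Indeed CM (h e) is finitely presented; let W (index k) consist
-- of the least element of W e (if any), together with b if k ∈ W k.  That some n-tuple generating
-- CM (h (index k)) satisfies the relations of CM (h e) is a c.e. property of k, say k ∈ W self.
-- Were self ∉ W self, then CM (h (index self)) ≅ CM (h e) would put self into W self; so
-- self ∈ W self, and e′ = index self has the required properties.
--
-- On the other hand, let Lead R be the upward closed set of those exponents that are not
-- lexicographically least in their class modulo a congruence R on ℕ^n.  If R ⊆ S and
-- Lead R = Lead S then R = S, and upward closed subsets of ℕ^n have ordinal rank at most ω^n,
-- and less than ω^n when nonempty.  Starting with W e = ∅ and enumerating ω^n, and then always the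
-- ordinal that bounds the rank of the current Lead, one obtains an infinite descent.
-- Classical steps are doubly negated, which is harmless since the goal is ⊥.

open import Defs renaming (refl to ~refl; sym to ~sym; trans to ~trans; assoc to ~assoc; comm to ~comm)
open import Data.Nat
  using (ℕ; zero; suc; pred; _+_; _∸_; _<_; _≤_; z≤n; s≤s; s≤s⁻¹; _≤?_; _<?_; _<ᵇ_; _≡ᵇ_)
open import Data.Nat.Properties
open import Data.Nat.Induction using (<-wellFounded)
open import Data.Fin using (Fin; zero; suc; toℕ; fromℕ<)
open import Data.Fin.Properties using (fromℕ<-toℕ; toℕ-fromℕ<; toℕ<n)
open import Data.Vec using (Vec; []; _∷_; lookup; map; tabulate; zipWith; replicate; insertAt)
open import Data.Vec.Properties
  using (tabulate-∘; tabulate∘lookup; tabulate-cong; lookup∘tabulate; insertAt-removeAt;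
         zipWith-comm; zipWith-assoc; zipWith-identityʳ)
import Data.Vec.Relation.Unary.All as VecAll
open import Data.Vec.Relation.Unary.All using ([]; _∷_)
open import Data.List using (List; []; _∷_; _++_; upTo; length)
import Data.List as List
open import Data.List.Relation.Unary.All as All using (All; []; _∷_)
open import Data.List.Relation.Unary.Any as Any using (Any; here; there; any?)
open import Data.List.Relation.Unary.Any.Properties using (++⁺ˡ; ++⁺ʳ; map⁺)
open import Data.List.Membership.Propositional.Properties using (∈-upTo⁺)
open import Data.Maybe using (Maybe; just; nothing)
open import Data.Product using (∃; _×_; _,_; proj₁; proj₂; map₁; map₂)
open import Data.Sum using (_⊎_; inj₁; inj₂)
open import Data.Empty using (⊥; ⊥-elim)
open import Data.Bool using (true; false; T)
open import Data.Unit using (⊤; tt)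
open import Function using (_∘_; id)
open import Function.Bundles using (_⇔_; mk⇔; Equivalence)
open import Algebra.Bundles using (CommutativeMonoid)
open import Algebra.Morphism.Structures using (module MonoidMorphisms)
open import Algebra.Properties.CommutativeSemigroup using (interchange)
open import Induction.WellFounded using (Acc; acc; WellFounded)
open import Relation.Nullary using (¬_; Dec; yes; no)
open import Relation.Binary.Definitions using (tri<; tri≈; tri>)
open import Relation.Binary.PropositionalEquality
  using (_≡_; refl; sym; trans; cong; cong₂; subst; subst₂)

open Equivalence using (to; from)

-- The diagonal argument needs an actual program for the event that some tuple generates
-- `CM (h (index k))` and satisfies given relations. Such a program involves a universal machine and
-- an enumeration of provable identities. Both, and the event itself, are expressed by one finite
-- system of Horn clauses over numbers, whose derivability is semi-decided by a single unbounded
-- search over codes of derivations. Kleene's recursion theorem is avoided: `index k` looks at the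
-- computation of `φ k` on k for every k, and the code of the event is put in for k only at the end.
--
-- An abstract isomorphism need not send x_i to x_i, so presentations cannot be compared directly.
-- Each stage of the descent therefore carries its own generating n-tuple σ, and the increasing
-- objects are the kernels `Ker (h e) σ` on ℕ^n.
--
-- Ranks are handled as relations bounding an upward closed set, not as computed values, because
-- membership in `Lead` is undecidable in general.

mutual
  Eval-deterministic : ∀ {k} {p : PR k} {xs y y′} → Eval p xs y → Eval p xs y′ → y ≡ y′
  Eval-deterministic ev-zer ev-zer = refl
  Eval-deterministic ev-succ ev-succ = refl
  Eval-deterministic ev-proj ev-proj = refl
  Eval-deterministic (ev-comp gs f) (ev-comp gs′ f′) with EvalVec-deterministic gs gs′
  ... | refl = Eval-deterministic f f′
  Eval-deterministic (ev-prec0 f) (ev-prec0 f′) = Eval-deterministic f f′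
  Eval-deterministic (ev-precS r g) (ev-precS r′ g′) with Eval-deterministic r r′
  ... | refl = Eval-deterministic g g′
  Eval-deterministic (ev-mu s) (ev-mu s′) = MuFrom-deterministic s s′

  EvalVec-deterministic : ∀ {k m} {gs : Vec (PR k) m} {xs ys ys′} →
                          EvalVec gs xs ys → EvalVec gs xs ys′ → ys ≡ ys′
  EvalVec-deterministic [] [] = refl
  EvalVec-deterministic (g ∷ gs) (g′ ∷ gs′) =
    cong₂ _∷_ (Eval-deterministic g g′) (EvalVec-deterministic gs gs′)

  MuFrom-deterministic : ∀ {k} {p : PR (suc k)} {xs z y y′} →
                         MuFrom p xs z y → MuFrom p xs z y′ → y ≡ y′
  MuFrom-deterministic (mu-here _) (mu-here _) = refl
  MuFrom-deterministic (mu-here p) (mu-next q _) with Eval-deterministic p q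
  ... | ()
  MuFrom-deterministic (mu-next q _) (mu-here p) with Eval-deterministic p q
  ... | ()
  MuFrom-deterministic (mu-next _ s) (mu-next _ s′) = MuFrom-deterministic s s′

-- The inverse of the diagonal enumeration of pairs

π₁ π₂ : ℕ → ℕ
π₁ = proj₁ ∘ unpair
π₂ = proj₂ ∘ unpair

tri : ℕ → ℕ
tri zero    = 0
tri (suc s) = suc s + tri s

n≤tri : ∀ n → n ≤ tri n
n≤tri zero    = z≤n
n≤tri (suc n) = m≤m+n (suc n) (tri n)

opaque
  -- The diagonal x + y = s starts at the triangular number `tri s` and is traversed with x
  -- increasing.
  pair : ℕ → ℕ → ℕ
  pair x y = tri (x + y) + x

  pair-def : ∀ x y → pair x y ≡ tri (x + y) + x
  pair-def _ _ = refl

  pair-zero : pair 0 0 ≡ 0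
  pair-zero = refl

  pair-next : ∀ x y → pair (suc x) y ≡ suc (pair x (suc y))
  pair-next x y = trans (+-suc (tri (suc (x + y))) x)
                        (cong (λ s → suc (tri s + x)) (sym (+-suc x y)))

  pair-wrap : ∀ x → pair 0 (suc x) ≡ suc (pair x 0)
  pair-wrap x = trans (+-identityʳ _)
    (cong suc (trans (+-comm x (tri x)) (cong (λ s → tri s + x) (sym (+-identityʳ x)))))

  m≤pair : ∀ x y → x ≤ pair x y
  m≤pair x y = m≤n+m x _

  n≤pair : ∀ x y → y ≤ pair x y
  n≤pair x y = ≤-trans (m≤n+m y x) (≤-trans (n≤tri (x + y)) (m≤m+n _ x))

n<pair : ∀ x y → y < pair (suc x) y
n<pair x y = subst (y <_) (sym (pair-next x y)) (s≤s (≤-trans (n≤1+n y) (n≤pair x (suc y))))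

unpair-pair : ∀ x y → unpair (pair x y) ≡ (x , y)
unpair-pair x y = go (pair x y) x y refl
  where
  go : ∀ n x y → pair x y ≡ n → unpair n ≡ (x , y)
  go zero    zero    zero    _  = refl
  go zero    zero    (suc y) eq with trans (sym (pair-wrap y)) eq
  ... | ()
  go zero    (suc x) y       eq with trans (sym (pair-next x y)) eq
  ... | ()
  go (suc n) zero    zero    eq with trans (sym pair-zero) eq
  ... | ()
  go (suc n) zero    (suc y) eq
    rewrite go n y 0 (suc-injective (trans (sym (pair-wrap y)) eq)) = refl
  go (suc n) (suc x) y       eq
    rewrite go n x (suc y) (suc-injective (trans (sym (pair-next x y)) eq)) = refl

π₁-pair : ∀ x y → π₁ (pair x y) ≡ x
π₁-pair x y = cong proj₁ (unpair-pair x y)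

π₂-pair : ∀ x y → π₂ (pair x y) ≡ y
π₂-pair x y = cong proj₂ (unpair-pair x y)

pair-unpair : ∀ n → pair (π₁ n) (π₂ n) ≡ n
pair-unpair zero = pair-zero
pair-unpair (suc n) with unpair n | pair-unpair n
... | x , zero  | eq = trans (pair-wrap x) (cong suc eq)
... | x , suc y | eq = trans (pair-next x y) (cong suc eq)

π₁≤ : ∀ n → π₁ n ≤ n
π₁≤ n = subst (π₁ n ≤_) (pair-unpair n) (m≤pair (π₁ n) (π₂ n))

π₂≤ : ∀ n → π₂ n ≤ n
π₂≤ n = subst (π₂ n ≤_) (pair-unpair n) (n≤pair (π₁ n) (π₂ n))

-- Computable total functions

record Fn (k : ℕ) : Set where
  field
    fun  : Vec ℕ k → ℕ
    code : PR k
    eval : ∀ xs → Eval code xs (fun xs)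

open Fn

variable
  k l : ℕ

evalVec : (Fs : Vec (Fn k) l) (xs : Vec ℕ k) →
          EvalVec (map code Fs) xs (map (λ F → fun F xs) Fs)
evalVec []       xs = []
evalVec (F ∷ Fs) xs = eval F xs ∷ evalVec Fs xs

varF : Fin k → Fn k
varF i = record { fun = λ xs → lookup xs i ; code = proj i ; eval = λ _ → ev-proj }

compF : Fn l → Vec (Fn k) l → Fn k
compF F Gs = record
  { fun  = λ xs → fun F (map (λ G → fun G xs) Gs)
  ; code = comp (code F) (map code Gs)
  ; eval = λ xs → ev-comp (evalVec Gs xs) (eval F _) }

precF : Fn k → Fn (suc (suc k)) → Fn (suc k)
precF {k} F G = record { fun = f ; code = prec (code F) (code G) ; eval = ev }
  where
  f : Vec ℕ (suc k) → ℕ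
  f (zero  ∷ xs) = fun F xs
  f (suc n ∷ xs) = fun G (n ∷ f (n ∷ xs) ∷ xs)
  ev : ∀ xs → Eval (prec (code F) (code G)) xs (f xs)
  ev (zero  ∷ xs) = ev-prec0 (eval F xs)
  ev (suc n ∷ xs) = ev-precS (ev (n ∷ xs)) (eval G _)

numeral : ℕ → PR k
numeral zero    = zer
numeral (suc c) = comp succ (numeral c ∷ [])

eval-numeral : ∀ c {xs : Vec ℕ k} → Eval (numeral c) xs c
eval-numeral zero    = ev-zer
eval-numeral (suc c) = ev-comp (eval-numeral c ∷ []) ev-succ

litF : ℕ → Fn k
litF c = record { fun = λ _ → c ; code = numeral c ; eval = λ _ → eval-numeral c }

-- The program is that of F, but the recorded function is the intended f; composites then compute to
-- the expected expressions by definition.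
lift₁ : (f : ℕ → ℕ) (F : Fn 1) → (∀ x → fun F (x ∷ []) ≡ f x) → Fn k → Fn k
lift₁ f F eq A = record
  { fun  = λ xs → f (fun A xs)
  ; code = code (compF F (A ∷ []))
  ; eval = λ xs → subst (Eval _ xs) (eq _) (eval (compF F (A ∷ [])) xs) }

lift₂ : (f : ℕ → ℕ → ℕ) (F : Fn 2) → (∀ x y → fun F (x ∷ y ∷ []) ≡ f x y) →
        Fn k → Fn k → Fn k
lift₂ f F eq A B = record
  { fun  = λ xs → f (fun A xs) (fun B xs)
  ; code = code (compF F (A ∷ B ∷ []))
  ; eval = λ xs → subst (Eval _ xs) (eq _ _) (eval (compF F (A ∷ B ∷ [])) xs) }

pattern x₀ = zero
pattern x₁ = suc zero
pattern x₃ = suc (suc (suc zero))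

sucF : Fn k → Fn k
sucF = lift₁ suc succF (λ _ → refl)
  where
  succF : Fn 1
  succF = record { fun = λ { (x ∷ []) → suc x } ; code = succ ; eval = λ { (_ ∷ []) → ev-succ } }

predF : Fn k → Fn k
predF = lift₁ pred (precF (litF 0) (varF x₀)) (λ { zero → refl ; (suc _) → refl })

infixl 6 _+F_ _∸F_
_+F_ : Fn k → Fn k → Fn k
_+F_ = lift₂ _+_ F eq
  where
  F : Fn 2
  F = precF (varF x₀) (sucF (varF x₁))
  eq : ∀ x y → fun F (x ∷ y ∷ []) ≡ x + y
  eq zero    y = refl
  eq (suc x) y = cong suc (eq x y)

_∸F_ : Fn k → Fn k → Fn k
A ∸F B = lift₂ (λ y x → x ∸ y) F eq B A
  where
  F : Fn 2
  F = precF (varF x₀) (predF (varF x₁))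
  eq : ∀ y x → fun F (y ∷ x ∷ []) ≡ x ∸ y
  eq zero    x = refl
  eq (suc y) x = trans (cong pred (eq y x)) (pred[m∸n]≡m∸[1+n] x y)

triF : Fn k → Fn k
triF = lift₁ tri F eq
  where
  F : Fn 1
  F = precF (litF 0) (sucF (varF x₀) +F varF x₁)
  eq : ∀ x → fun F (x ∷ []) ≡ tri x
  eq zero    = refl
  eq (suc x) = cong (suc x +_) (eq x)

pairF : Fn k → Fn k → Fn k
pairF = lift₂ pair (triF (varF x₀ +F varF x₁) +F varF x₀) (λ x y → sym (pair-def x y))

ifz : ℕ → ℕ → ℕ → ℕ
ifz zero    a b = a
ifz (suc _) a b = b

ifzF : Fn k → Fn k → Fn k → Fn k
ifzF A B C = record
  { fun  = λ xs → ifz (fun A xs) (fun B xs) (fun C xs)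
  ; code = code G
  ; eval = λ xs → subst (Eval _ xs) (eq (fun A xs)) (eval G xs) }
  where
  F : Fn 3
  F = precF (varF x₀) (varF x₃)
  G : Fn _
  G = compF F (A ∷ B ∷ C ∷ [])
  eq : ∀ a {b c} → fun F (a ∷ b ∷ c ∷ []) ≡ ifz a b c
  eq zero    = refl
  eq (suc a) = refl

dist : ℕ → ℕ → ℕ
dist x y = (x ∸ y) + (y ∸ x)

distF : Fn k → Fn k → Fn k
distF A B = (A ∸F B) +F (B ∸F A)

dist-refl : ∀ x → dist x x ≡ 0
dist-refl x rewrite n∸n≡0 x = refl

dist≡0⇒≡ : ∀ x y → dist x y ≡ 0 → x ≡ y
dist≡0⇒≡ x y eq = ≤-antisym (m∸n≡0⇒m≤n (m+n≡0⇒m≡0 (x ∸ y) eq))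
                            (m∸n≡0⇒m≤n (m+n≡0⇒n≡0 (x ∸ y) eq))

pair-column : ∀ x → pair x 0 ≡ x + tri x
pair-column x = suc-injective
  (trans (sym (pair-wrap x)) (trans (pair-def 0 (suc x)) (+-identityʳ _)))

-- The number x + y of the diagonal on which the code of (x , y) lies;
-- it jumps exactly at the triangular numbers.
diagonal : ℕ → ℕ
diagonal zero    = 0
diagonal (suc n) = ifz (dist (suc n) (tri (suc (diagonal n)))) (suc (diagonal n)) (diagonal n)

diagonal-unpair : ∀ n → diagonal n ≡ π₁ n + π₂ n
diagonal-unpair zero = refl
diagonal-unpair (suc n) with unpair n | pair-unpair n | diagonal-unpair n
... | x , zero | eq | d
  rewrite d | +-identityʳ x | sym (trans (sym (pair-column x)) eq) | dist-refl (suc (x + tri x)) = refl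
... | x , suc y | eq | d with dist (suc n) (tri (suc (diagonal n))) in q
...   | suc _ = trans d (+-suc x y)
-- The next jump is at `tri (suc s)` with s = x + suc y, and this exceeds `suc n` because x < s.
...   | zero  = ⊥-elim (<-irrefl (trans (cong suc n≡) (dist≡0⇒≡ (suc n) _ q)) lt)
  where
  n≡ : tri (x + suc y) + x ≡ n
  n≡ = trans (sym (pair-def x (suc y))) eq
  lt : suc (tri (x + suc y) + x) < tri (suc (diagonal n))
  lt = subst (λ s → suc (tri (x + suc y) + x) < tri (suc s)) (sym d)
         (s≤s (subst (_< (x + suc y) + tri (x + suc y)) (+-comm x (tri (x + suc y)))
           (+-monoˡ-< (tri (x + suc y)) (m<m+n x (s≤s z≤n)))))

diagonalF : Fn k → Fn k
diagonalF = lift₁ diagonal F eq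
  where
  F : Fn 1
  F = precF (litF 0)
        (ifzF (distF (sucF (varF x₀)) (triF (sucF (varF x₁)))) (sucF (varF x₁)) (varF x₁))
  eq : ∀ n → fun F (n ∷ []) ≡ diagonal n
  eq zero = refl
  eq (suc n) rewrite eq n = refl

π₁-diagonal : ∀ n → n ∸ tri (diagonal n) ≡ π₁ n
π₁-diagonal n = trans
  (cong₂ _∸_ (trans (sym (pair-unpair n)) (pair-def (π₁ n) (π₂ n))) (cong tri (diagonal-unpair n)))
  (m+n∸m≡n (tri (π₁ n + π₂ n)) (π₁ n))

π₁F π₂F : Fn k → Fn k
π₁F = lift₁ π₁ (varF x₀ ∸F triF (diagonalF (varF x₀))) π₁-diagonal
π₂F = lift₁ π₂ (diagonalF (varF x₀) ∸F π₁F (varF x₀))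
  (λ n → trans (cong (_∸ π₁ n) (diagonal-unpair n)) (m+n∸m≡n (π₁ n) (π₂ n)))

decV : (k : ℕ) → ℕ → Vec ℕ k
decV zero    c = []
decV (suc k) c = π₁ c ∷ decV k (π₂ c)

encV : Vec ℕ k → ℕ
encV []       = 0
encV (x ∷ xs) = pair x (encV xs)

decV-∷ : ∀ k x c → decV (suc k) (pair x c) ≡ x ∷ decV k c
decV-∷ k x c rewrite unpair-pair x c = refl

decV-encV : (xs : Vec ℕ k) → decV k (encV xs) ≡ xs
decV-encV []       = refl
decV-encV {suc k} (x ∷ xs) = trans (decV-∷ k x (encV xs)) (cong (x ∷_) (decV-encV xs))

decVF : (k : ℕ) → Fn l → Vec (Fn l) k
decVF zero    A = []
decVF (suc k) A = π₁F A ∷ decVF k (π₂F A)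

fun-decVF : ∀ k (A : Fn l) xs → map (λ F → fun F xs) (decVF k A) ≡ decV k (fun A xs)
fun-decVF zero    A xs = refl
fun-decVF (suc k) A xs = cong (_ ∷_) (fun-decVF k (π₂F A) xs)

minimise-sound : ∀ (F : Fn (suc k)) xs {y} → Eval (mu (code F)) xs y → ∃ λ d → fun F (d ∷ xs) ≡ 0
minimise-sound F xs (ev-mu s) = go s
  where
  go : ∀ {z y} → MuFrom (code F) xs z y → ∃ λ d → fun F (d ∷ xs) ≡ 0
  go (mu-next _ s)   = go s
  go {z} (mu-here e) = z , Eval-deterministic (eval F (z ∷ xs)) e

minimise-complete : ∀ (F : Fn (suc k)) xs d → fun F (d ∷ xs) ≡ 0 → ∃ λ y → Eval (mu (code F)) xs y
minimise-complete F xs d eq = map₂ ev-mu (go d 0 (+-identityʳ d))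
  where
  go : ∀ j z → j + z ≡ d → ∃ λ y → MuFrom (code F) xs z y
  go zero    z refl = z , mu-here (subst (Eval _ _) eq (eval F (z ∷ xs)))
  go (suc j) z p with fun F (z ∷ xs) in q
  ... | zero  = z , mu-here (subst (Eval _ _) q (eval F (z ∷ xs)))
  ... | suc _ = map₂ (mu-next (subst (Eval _ _) q (eval F (z ∷ xs))))
                     (go j (suc z) (trans (+-suc j z) p))

-- Horn clauses

record Rule : Set where
  field
    vars              : ℕ
    prem₁ prem₂ concl : Fn vars

open Rule

module Horn (rule : ℕ → Rule) (size : ℕ) where

  -- The judgement 0 always holds. It fills the premises that an axiom lacks, and as the value of
  -- ill-formed codes it ensures that every number codes a derivation of something.
  data Der : ℕ → Set where
    base : Der 0
    by   : ∀ r {_ : T (r <ᵇ size)} v →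
           Der (fun (prem₁ (rule r)) v) → Der (fun (prem₂ (rule r)) v) → Der (fun (concl (rule r)) v)

  -- The sum of the two distances vanishes exactly when a and b are the premises of the instance
  -- coded by c; otherwise the result is the harmless judgement 0.
  apply : Rule → ℕ → ℕ → ℕ → ℕ
  apply R a b c = ifz (dist a (fun (prem₁ R) v) + dist b (fun (prem₂ R) v)) (fun (concl R) v) 0
    where
    v : Vec ℕ (vars R)
    v = decV (vars R) c

  applyF : Rule → Fn k → Fn k → Fn k → Fn k
  applyF R A B C = ifzF (distF A (compF (prem₁ R) V) +F distF B (compF (prem₂ R) V))
                        (compF (concl R) V) (litF 0)
    where
    V : Vec (Fn _) (vars R)
    V = decVF (vars R) C

  fun-applyF : ∀ R (A B C : Fn k) xs →
               fun (applyF R A B C) xs ≡ apply R (fun A xs) (fun B xs) (fun C xs)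
  fun-applyF R A B C xs = cong
    (λ v → ifz (dist (fun A xs) (fun (prem₁ R) v) + dist (fun B xs) (fun (prem₂ R) v)) (fun (concl R) v) 0)
    (fun-decVF (vars R) C xs)

  dispatch : (ℕ → Rule) → ℕ → ℕ → ℕ → ℕ → ℕ → ℕ
  dispatch ρ zero    r a b c = 0
  dispatch ρ (suc s) r a b c = ifz r (apply (ρ 0) a b c) (dispatch (ρ ∘ suc) s (pred r) a b c)

  dispatchF : (ρ : ℕ → Rule) (s : ℕ) → Fn k → Fn k → Fn k → Fn k → Fn k
  dispatchF ρ zero    R A B C = litF 0
  dispatchF ρ (suc s) R A B C = ifzF R (applyF (ρ 0) A B C) (dispatchF (ρ ∘ suc) s (predF R) A B C)

  fun-dispatchF : ∀ ρ s (R A B C : Fn k) xs → fun (dispatchF ρ s R A B C) xs ≡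
                  dispatch ρ s (fun R xs) (fun A xs) (fun B xs) (fun C xs)
  fun-dispatchF ρ zero    R A B C xs = refl
  fun-dispatchF ρ (suc s) R A B C xs = cong₂ (ifz (fun R xs))
    (fun-applyF (ρ 0) A B C xs) (fun-dispatchF (ρ ∘ suc) s (predF R) A B C xs)

  step : ℕ → ℕ → ℕ → ℕ
  step i a b = dispatch rule size (π₁ i) a b (π₂ i)

  stepF : Fn k → Fn k → Fn k → Fn k
  stepF {k} I A B = record
    { fun  = λ xs → step (fun I xs) (fun A xs) (fun B xs)
    ; code = code G
    ; eval = λ xs → subst (Eval (code G) xs) (fun-dispatchF rule size (π₁F I) A B (π₂F I) xs) (eval G xs) }
    where
    G : Fn k
    G = dispatchF rule size (π₁F I) A B (π₂F I)

  drops : ℕ → ℕ → ℕ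
  drops zero    t = t
  drops (suc j) t = π₂ (drops j t)

  drops-π₂ : ∀ j t → drops j (π₂ t) ≡ drops (suc j) t
  drops-π₂ zero    t = refl
  drops-π₂ (suc j) t = cong π₂ (drops-π₂ j t)

  dropsF : Fn k → Fn k → Fn k
  dropsF = lift₂ drops F eq
    where
    F : Fn 2
    F = precF (varF x₀) (π₂F (varF x₁))
    eq : ∀ j t → fun F (j ∷ t ∷ []) ≡ drops j t
    eq zero    t = refl
    eq (suc j) t = cong π₂ (eq j t)

  -- A derivation is coded by d = 1 + ⟨i , ⟨d₁ , d₂⟩⟩, where i codes the last rule with its arguments
  -- and d₁, d₂ code the derivations of its premises; an ill-formed d gets the value 0.  This is
  -- course-of-values recursion: table d lists value d , … , value 0.
  tableStep : ℕ → ℕ → ℕ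
  tableStep c t = pair
    (step (π₁ c) (π₁ (drops (c ∸ π₁ (π₂ c)) t)) (π₁ (drops (c ∸ π₂ (π₂ c)) t))) t

  table : ℕ → ℕ
  table zero    = 0
  table (suc c) = tableStep c (table c)

  value : ℕ → ℕ
  value d = π₁ (table d)

  opaque
    valueF : Fn k → Fn k
    valueF A = π₁F (lift₁ table F eq A)
      where
      entry : Fn 2 → Fn 2
      entry D = π₁F (dropsF (varF x₀ ∸F D) (varF x₁))
      F : Fn 1
      F = precF (litF 0)
            (pairF (stepF (π₁F (varF x₀)) (entry (π₁F (π₂F (varF x₀)))) (entry (π₂F (π₂F (varF x₀)))))
                   (varF x₁))
      eq : ∀ d → fun F (d ∷ []) ≡ table d
      eq zero    = refl
      eq (suc d) = cong (tableStep d) (eq d)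

    fun-valueF : ∀ (A : Fn k) xs → fun (valueF A) xs ≡ value (fun A xs)
    fun-valueF A xs = refl

  drops-table : ∀ j d → drops j (table (j + d)) ≡ table d
  drops-table zero    d = refl
  drops-table (suc j) d = trans (sym (drops-π₂ j _))
    (trans (cong (drops j) (π₂-pair _ (table (j + d)))) (drops-table j d))

  value-lookup : ∀ {c d} → d ≤ c → π₁ (drops (c ∸ d) (table c)) ≡ value d
  value-lookup {c} {d} d≤c = cong π₁
    (trans (cong (λ s → drops (c ∸ d) (table s)) (sym (m∸n+n≡m d≤c))) (drops-table (c ∸ d) d))

  value-suc : ∀ c → value (suc c) ≡ step (π₁ c) (value (π₁ (π₂ c))) (value (π₂ (π₂ c)))
  value-suc c = trans (π₁-pair _ (table c))
    (cong₂ (step (π₁ c)) (value-lookup (≤-trans (π₁≤ (π₂ c)) (π₂≤ c)))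
                         (value-lookup (≤-trans (π₂≤ (π₂ c)) (π₂≤ c))))

  value-pair : ∀ i a b → value (suc (pair i (pair a b))) ≡ step i (value a) (value b)
  value-pair i a b = trans (value-suc (pair i (pair a b))) (trans
    (cong₂ (λ j m → step j (value (π₁ m)) (value (π₂ m)))
           (π₁-pair i (pair a b)) (π₂-pair i (pair a b)))
    (cong₂ (λ m n → step i (value m) (value n)) (π₁-pair a b) (π₂-pair a b)))

  dispatch-rule : ∀ ρ s r v → T (r <ᵇ s) →
    dispatch ρ s r (fun (prem₁ (ρ r)) v) (fun (prem₂ (ρ r)) v) (encV v) ≡ fun (concl (ρ r)) v
  dispatch-rule ρ (suc s) zero    v _
    rewrite decV-encV v
          | dist-refl (fun (prem₁ (ρ 0)) v) | dist-refl (fun (prem₂ (ρ 0)) v) = refl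
  dispatch-rule ρ (suc s) (suc r) v p = dispatch-rule (ρ ∘ suc) s r v p

  Der⇒value : ∀ {j} → Der j → ∃ λ d → value d ≡ j
  Der⇒value base = 0 , refl
  Der⇒value (by r {p} v x y) with Der⇒value x | Der⇒value y
  ... | a , eqa | b , eqb = suc (pair i (pair a b)) ,
    trans (value-pair i a b) (trans (cong₂ (step i) eqa eqb) (trans
      (cong₂ (λ r′ → dispatch rule size r′ (fun (prem₁ (rule r)) v) (fun (prem₂ (rule r)) v))
             (π₁-pair r (encV v)) (π₂-pair r (encV v)))
      (dispatch-rule rule size r v p)))
    where
    i : ℕ
    i = pair r (encV v)

  -- Either a rule fired on matching premises or the default 0 came out. The family ρ is general
  -- because the induction on s shifts it.
  dispatch-closed : ∀ (P : ℕ → Set) ρ s r {a b} c → P 0 →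
    (∀ r → T (r <ᵇ s) → ∀ v → a ≡ fun (prem₁ (ρ r)) v → b ≡ fun (prem₂ (ρ r)) v →
     P (fun (concl (ρ r)) v)) →
    P (dispatch ρ s r a b c)
  dispatch-closed P ρ zero    r c p₀ h = p₀
  dispatch-closed P ρ (suc s) (suc r) c p₀ h = dispatch-closed P (ρ ∘ suc) s r c p₀ (h ∘ suc)
  dispatch-closed P ρ (suc s) zero {a} {b} c p₀ h
    with dist a (fun (prem₁ (ρ 0)) (decV _ c)) + dist b (fun (prem₂ (ρ 0)) (decV _ c)) in q
  ... | suc _ = p₀
  ... | zero  = h 0 _ _ (dist≡0⇒≡ a _ (m+n≡0⇒m≡0 _ q))
                        (dist≡0⇒≡ b _ (m+n≡0⇒n≡0 (dist a (fun (prem₁ (ρ 0)) (decV _ c))) q))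

  -- Course-of-values induction: the codes of both subderivations are smaller than d.
  value-Der : ∀ d → Der (value d)
  value-Der d = go (suc d) d ≤-refl
    where
    go : ∀ s d → d < s → Der (value d)
    go (suc s) zero    _ = base
    go (suc s) (suc c) (s≤s c<s) = subst Der (sym (value-suc c))
      (dispatch-closed Der rule size (π₁ (π₁ c)) (π₂ (π₁ c)) base
        (λ r p v eqa eqb → by r {p} v
          (subst Der eqa (go s _ (≤-<-trans (≤-trans (π₁≤ (π₂ c)) (π₂≤ c)) c<s)))
          (subst Der eqb (go s _ (≤-<-trans (≤-trans (π₂≤ (π₂ c)) (π₂≤ c)) c<s)))))

  searchTest : Fn k → Fn (suc k)
  searchTest {k} t = distF (valueF (varF zero)) (compF t (tailF k))
    where
    tailF : ∀ k → Vec (Fn (suc k)) k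
    tailF k = Data.Vec.tabulate (λ i → varF (suc i))

  fun-searchTest : ∀ (t : Fn k) d xs → fun (searchTest t) (d ∷ xs) ≡ dist (value d) (fun t xs)
  fun-searchTest t d xs = cong₂ (λ v ys → dist v (fun t ys))
    (fun-valueF (varF zero) (d ∷ xs)) (eq xs d xs (λ _ → refl))
    where
    eq : ∀ {k} (xs : Vec ℕ k) d (ys : Vec ℕ k) → (∀ i → lookup ys i ≡ lookup xs i) →
         map (λ F → fun F (d ∷ ys)) (Data.Vec.tabulate (λ i → varF (suc i))) ≡ xs
    eq xs d ys e = trans (sym (tabulate-∘ _ _)) (trans (tabulate-cong e) (tabulate∘lookup xs))

  -- Derivability becomes halting: the program looks for a d whose `value` is the judgement in
  -- question, and `value` is total and computable.
  search : Fn k → PR k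
  search t = mu (code (searchTest t))

  search-sound : ∀ (t : Fn k) xs {y} → Eval (search t) xs y → Der (fun t xs)
  search-sound t xs e with minimise-sound (searchTest t) xs e
  ... | d , eq = subst Der (dist≡0⇒≡ _ _ (trans (sym (fun-searchTest t d xs)) eq)) (value-Der d)

  search-complete : ∀ (t : Fn k) xs → Der (fun t xs) → ∃ λ y → Eval (search t) xs y
  search-complete t xs x with Der⇒value x
  ... | d , eq = minimise-complete (searchTest t) xs d
    (trans (fun-searchTest t d xs) (trans (cong (λ s → dist s (fun t xs)) eq) (dist-refl (fun t xs))))

-- Codes of programs

decode-zer : ∀ f k r → decodePR (suc f) k (pair 0 r) ≡ zer
decode-zer f k r rewrite unpair-pair 0 r = refl

decode-succ : ∀ f r → decodePR (suc f) 1 (pair 1 r) ≡ succ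
decode-succ f r rewrite unpair-pair 1 r = refl

decode-succ₀ : ∀ f r → decodePR (suc f) 0 (pair 1 r) ≡ zer
decode-succ₀ f r rewrite unpair-pair 1 r = refl

decode-succ₂ : ∀ f k r → decodePR (suc f) (suc (suc k)) (pair 1 r) ≡ zer
decode-succ₂ f k r rewrite unpair-pair 1 r = refl

decode-proj₀ : ∀ f r → decodePR (suc f) 0 (pair 2 r) ≡ zer
decode-proj₀ f r rewrite unpair-pair 2 r = refl

decode-proj : ∀ f k r → decodePR (suc f) (suc k) (pair 2 r) ≡ proj (toFin k r)
decode-proj f zero r rewrite unpair-pair 2 r = refl
decode-proj f (suc k) r rewrite unpair-pair 2 r = refl

decode-comp : ∀ f k m a b → decodePR (suc f) k (pair 3 (pair m (pair a b))) ≡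
              comp (decodePR f m a) (decodeVecPR f k m b)
decode-comp f zero m a b
  rewrite unpair-pair 3 (pair m (pair a b)) | unpair-pair m (pair a b) | unpair-pair a b = refl
decode-comp f (suc zero) m a b
  rewrite unpair-pair 3 (pair m (pair a b)) | unpair-pair m (pair a b) | unpair-pair a b = refl
decode-comp f (suc (suc k)) m a b
  rewrite unpair-pair 3 (pair m (pair a b)) | unpair-pair m (pair a b) | unpair-pair a b = refl

decode-prec₀ : ∀ f r → decodePR (suc f) 0 (pair 4 r) ≡ zer
decode-prec₀ f r rewrite unpair-pair 4 r = refl

decode-prec : ∀ f k a b → decodePR (suc f) (suc k) (pair 4 (pair a b)) ≡
              prec (decodePR f k a) (decodePR f (suc (suc k)) b)
decode-prec f zero a b rewrite unpair-pair 4 (pair a b) | unpair-pair a b = refl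
decode-prec f (suc k) a b rewrite unpair-pair 4 (pair a b) | unpair-pair a b = refl

decode-mu : ∀ f k r → decodePR (suc f) k (pair 5 r) ≡ mu (decodePR f (suc k) r)
decode-mu f zero r rewrite unpair-pair 5 r = refl
decode-mu f (suc zero) r rewrite unpair-pair 5 r = refl
decode-mu f (suc (suc k)) r rewrite unpair-pair 5 r = refl

decode-junk : ∀ f k t r → decodePR (suc f) k (pair (6 + t) r) ≡ zer
decode-junk f zero t r rewrite unpair-pair (6 + t) r = refl
decode-junk f (suc zero) t r rewrite unpair-pair (6 + t) r = refl
decode-junk f (suc (suc k)) t r rewrite unpair-pair (6 + t) r = refl

decodeVec-∷ : ∀ f k m a b → decodeVecPR f k (suc m) (pair a b) ≡
              decodePR f k a ∷ decodeVecPR f k m b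
decodeVec-∷ f k m a b rewrite unpair-pair a b = refl

mutual
  encode : PR k → ℕ
  encode zer                   = pair 0 0
  encode succ                  = pair 1 0
  encode (proj i)              = pair 2 (toℕ i)
  encode (comp {m = m} p qs)   = pair 3 (pair m (pair (encode p) (encodeVec qs)))
  encode (prec p q)            = pair 4 (pair (encode p) (encode q))
  encode (mu p)                = pair 5 (encode p)

  encodeVec : Vec (PR k) l → ℕ
  encodeVec []       = 0
  encodeVec (p ∷ ps) = pair (encode p) (encodeVec ps)

toFin-toℕ : ∀ {m} (i : Fin (suc m)) → toFin m (toℕ i) ≡ i
toFin-toℕ {zero}  zero    = refl
toFin-toℕ {suc m} zero    = refl
toFin-toℕ {suc m} (suc i) = cong suc (toFin-toℕ i)

-- A nonzero tag makes the code strictly larger than its payload, which pays for the unit of fuel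
-- spent on each constructor.
tagged-< : ∀ {t r s} → pair (suc t) r < suc s → r < s
tagged-< {t} {r} (s≤s p) = <-≤-trans (n<pair t r) p

mutual
  decode-encode : ∀ f (p : PR k) → encode p < f → decodePR f k (encode p) ≡ p
  decode-encode {k} (suc f) zer _ = decode-zer f k 0
  decode-encode (suc f) succ _ = decode-succ f 0
  decode-encode {suc k} (suc f) (proj i) _ =
    trans (decode-proj f k (toℕ i)) (cong proj (toFin-toℕ i))
  decode-encode {k} (suc f) (comp {m = m} p qs) lt =
    trans (decode-comp f k m (encode p) (encodeVec qs))
      (cong₂ comp (decode-encode f p (≤-<-trans (m≤pair _ _) lt₂))
                  (decodeVec-encodeVec f qs (≤-<-trans (n≤pair (encode p) _) lt₂)))
    where
    lt₂ : pair (encode p) (encodeVec qs) < f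
    lt₂ = ≤-<-trans (n≤pair m _) (tagged-< lt)
  decode-encode {suc k} (suc f) (prec p q) lt =
    trans (decode-prec f k (encode p) (encode q))
      (cong₂ prec (decode-encode f p (≤-<-trans (m≤pair _ (encode q)) (tagged-< lt)))
                  (decode-encode f q (≤-<-trans (n≤pair (encode p) _) (tagged-< lt))))
  decode-encode {k} (suc f) (mu p) lt =
    trans (decode-mu f k (encode p)) (cong mu (decode-encode f p (tagged-< lt)))

  decodeVec-encodeVec : ∀ f (ps : Vec (PR k) l) → encodeVec ps < f →
                        decodeVecPR f k l (encodeVec ps) ≡ ps
  decodeVec-encodeVec f [] _ = refl
  decodeVec-encodeVec {k} {suc l} f (p ∷ ps) lt =
    trans (decodeVec-∷ f k l (encode p) (encodeVec ps))
      (cong₂ _∷_ (decode-encode f p (≤-<-trans (m≤pair _ (encodeVec ps)) lt))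
                 (decodeVec-encodeVec f ps (≤-<-trans (n≤pair (encode p) _) lt)))

φ-encode : (p : PR 1) → φ (encode p) ≡ p
φ-encode p = decode-encode (suc (encode p)) p ≤-refl

-- Parameters: the s-m-n theorem

specialise : PR 2 → ℕ → PR 1
specialise Q c = comp Q (numeral c ∷ proj zero ∷ [])

eval-specialise : ∀ {Q c x y} → Eval Q (c ∷ x ∷ []) y → Eval (specialise Q c) (x ∷ []) y
eval-specialise {c = c} e = ev-comp (eval-numeral c ∷ ev-proj ∷ []) e

specialise-eval : ∀ {Q c x y} → Eval (specialise Q c) (x ∷ []) y → Eval Q (c ∷ x ∷ []) y
specialise-eval {Q} {c} {x} {y} (ev-comp (e ∷ ev-proj ∷ []) q) =
  subst (λ z → Eval Q (z ∷ x ∷ []) y) (Eval-deterministic e (eval-numeral c)) q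

-- In the code of `specialise Q c` only the code of the numeral depends on c, and that one is built
-- by primitive recursion on c.
encode-specialiseF : PR 2 → Fn k → Fn k
encode-specialiseF Q = lift₁ (λ c → encode (specialise Q c))
  (pairF (litF 3) (pairF (litF 2) (pairF (litF (encode Q))
    (pairF F (litF (encodeVec {1} (proj zero ∷ [])))))))
  (λ c → cong (λ d → pair 3 (pair 2 (pair (encode Q) (pair d (encodeVec {1} (proj zero ∷ [])))))) (eq c))
  where
  F : Fn 1
  F = precF (litF (encode {1} zer)) (pairF (litF 3) (pairF (litF 1)
        (pairF (litF (encode succ)) (pairF (varF x₁) (litF 0)))))
  eq : ∀ c → Fn.fun F (c ∷ []) ≡ encode {1} (numeral c)
  eq zero    = refl
  eq (suc c) = cong (λ d → pair 3 (pair 1 (pair (encode succ) (pair d 0)))) (eq c)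

-- Codes of terms

encodeTerm : ∀ {n} → Term n → ℕ
encodeTerm (var i)      = toℕ i
encodeTerm {n} ε        = n
encodeTerm {n} (s · t)  = suc n + pair (encodeTerm s) (encodeTerm t)

≡ᵇ-refl : ∀ n → (n ≡ᵇ n) ≡ true
≡ᵇ-refl zero    = refl
≡ᵇ-refl (suc n) = ≡ᵇ-refl n

module _ (m : ℕ) where
  private
    n : ℕ
    n = suc m

  decodeTerm-var : ∀ f {k} (k<n : k < n) → decodeTerm n (suc f) k ≡ var (fromℕ< k<n)
  decodeTerm-var f {k} k<n with k <? n
  ... | yes _  = refl
  ... | no k≮n = ⊥-elim (k≮n k<n)

  decodeTerm-ε : ∀ f → decodeTerm n (suc f) n ≡ ε
  decodeTerm-ε f with n <? n
  ... | yes n<n = ⊥-elim (<-irrefl refl n<n)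
  ... | no _ rewrite ≡ᵇ-refl m = refl

  decodeTerm-· : ∀ f c → decodeTerm n (suc f) (suc n + c) ≡
                 decodeTerm n f (π₁ c) · decodeTerm n f (π₂ c)
  decodeTerm-· f c with suc n + c <? n
  ... | yes lt = ⊥-elim (m+n≮m n (suc c) (subst (_< n) (sym (+-suc n c)) lt))
  ... | no _ with suc n + c ≡ᵇ n in eq
  ...   | true  = ⊥-elim (m+1+n≢m n {c} (trans (+-suc n c) (≡ᵇ⇒≡ (suc n + c) n (subst T (sym eq) tt))))
  ...   | false rewrite m+n∸m≡n n c = refl

  data Code : ℕ → Set where
    var-code : ∀ {k} → k < n → Code k
    ε-code   : Code n
    ·-code   : ∀ c → Code (suc n + c)

  classify : ∀ k → Code k
  classify k with <-cmp k n
  ... | tri< k<n _ _ = var-code k<n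
  ... | tri≈ _ refl _ = ε-code
  ... | tri> _ _ n<k = subst Code (m+[n∸m]≡n n<k) (·-code (k ∸ suc n))

  n<1+n+c : ∀ c → c < suc n + c
  n<1+n+c c = s≤s (m≤n+m c n)

  -- A product hands its whole remaining fuel to both factors, whereas `termOf` gives each factor
  -- only the fuel fitting its own code; the two must agree.
  decodeTerm-fuel : ∀ f f′ k → k < f → k < f′ → decodeTerm n f k ≡ decodeTerm n f′ k
  decodeTerm-fuel (suc f) (suc f′) k p p′ with classify k
  ... | var-code k<n = trans (decodeTerm-var f k<n) (sym (decodeTerm-var f′ k<n))
  ... | ε-code       = trans (decodeTerm-ε f) (sym (decodeTerm-ε f′))
  ... | ·-code c     = trans (decodeTerm-· f c) (trans
    (cong₂ _·_ (decodeTerm-fuel f f′ (π₁ c) (lt (π₁≤ c) p) (lt (π₁≤ c) p′))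
               (decodeTerm-fuel f f′ (π₂ c) (lt (π₂≤ c) p) (lt (π₂≤ c) p′)))
    (sym (decodeTerm-· f′ c)))
    where
    lt : ∀ {d f} → d ≤ c → suc n + c < suc f → d < f
    lt d≤c (s≤s q) = ≤-<-trans d≤c (<-≤-trans (n<1+n+c c) q)

  termOf-var : ∀ {k} (k<n : k < n) → termOf n k ≡ var (fromℕ< k<n)
  termOf-var {k} = decodeTerm-var k

  termOf-ε : termOf n n ≡ ε
  termOf-ε = decodeTerm-ε n

  termOf-π : ∀ c → termOf n (suc n + c) ≡ termOf n (π₁ c) · termOf n (π₂ c)
  termOf-π c = trans (decodeTerm-· (suc n + c) c) (cong₂ _·_
    (decodeTerm-fuel _ _ (π₁ c) (≤-<-trans (π₁≤ c) (n<1+n+c c)) ≤-refl)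
    (decodeTerm-fuel _ _ (π₂ c) (≤-<-trans (π₂≤ c) (n<1+n+c c)) ≤-refl))

  termOf-· : ∀ a b → termOf n (suc n + pair a b) ≡ termOf n a · termOf n b
  termOf-· a b = trans (termOf-π (pair a b))
    (cong₂ (λ c d → termOf n c · termOf n d) (π₁-pair a b) (π₂-pair a b))

  termOf-encodeTerm : ∀ t → termOf n (encodeTerm t) ≡ t
  termOf-encodeTerm (var i) = trans (termOf-var (toℕ<n i)) (cong var (fromℕ<-toℕ i (toℕ<n i)))
  termOf-encodeTerm ε       = termOf-ε
  termOf-encodeTerm (s · t) = trans (termOf-· (encodeTerm s) (encodeTerm t))
    (cong₂ _·_ (termOf-encodeTerm s) (termOf-encodeTerm t))

  encodeTerm-decodeTerm : ∀ f k → k < f → encodeTerm (decodeTerm n f k) ≡ k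
  encodeTerm-decodeTerm (suc f) k lt with classify k
  ... | var-code k<n = trans (cong encodeTerm (decodeTerm-var f k<n)) (toℕ-fromℕ< k<n)
  ... | ε-code       = cong encodeTerm (decodeTerm-ε f)
  ... | ·-code c     = trans (cong encodeTerm (decodeTerm-· f c))
    (cong (suc n +_) (trans (cong₂ pair (encodeTerm-decodeTerm f _ (≤-<-trans (π₁≤ c) c<f))
                                        (encodeTerm-decodeTerm f _ (≤-<-trans (π₂≤ c) c<f)))
                            (pair-unpair c)))
    where
    c<f : c < f
    c<f = <-≤-trans (n<1+n+c c) (s≤s⁻¹ lt)

  encodeTerm-termOf : ∀ k → encodeTerm (termOf n k) ≡ k
  encodeTerm-termOf k = encodeTerm-decodeTerm (suc k) k ≤-refl

sub : ∀ {n p} → (Fin n → Term p) → Term n → Term p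
sub σ (var i) = σ i
sub σ ε       = ε
sub σ (s · t) = sub σ s · sub σ t

≡⇒~ : ∀ {n} {R : Term n → Term n → Set} {s t} → s ≡ t → Cong R s t
≡⇒~ refl = ~refl

≡⇒ : ∀ {k} {p q : PR k} {xs y} → p ≡ q → Eval p xs y → Eval q xs y
≡⇒ refl e = e

≡⇐ : ∀ {k} {p q : PR k} {xs y} → p ≡ q → Eval q xs y → Eval p xs y
≡⇐ refl e = e

-- Judgements

pattern EV  = 1
pattern EVV = 2
pattern MU  = 3
pattern LK  = 4
pattern CG  = 5
pattern NUM = 6
pattern IMG = 7
pattern EQ  = 8
pattern REL = 9
pattern SP  = 10
pattern EVT = 11
pattern MEM = 12

-- `EV`, `EVV`, `MU` and `LK` concern evaluation of coded programs, program vectors, minimisations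
-- and projections; `CG` is the congruence. For a coded tuple of terms, `IMG` gives the image of a
-- term under substitution, `EQ` equality of two images, `REL` a list of such equalities, and `SP`
-- that the first few generators are reached. `EVT` is the event, `MEM` membership in `W (index k)`,
-- and `NUM` holds at n only, serving as a bound test.
arity : ℕ → ℕ
arity EV  = 5
arity EVV = 6
arity MU  = 6
arity LK  = 4
arity CG  = 3
arity NUM = 1
arity IMG = 4
arity EQ  = 4
arity REL = 4
arity SP  = 3
arity EVT = 3
arity MEM = 2
arity _   = 0

infix 4 _!_ _!F_

_!_ : (t : ℕ) → Vec ℕ (arity t) → ℕ
t ! v = pair t (encV v)

data Atom (k : ℕ) : Set where
  _!F_ : (t : ℕ) → Vec (Fn k) (arity t) → Atom k

encVF : Vec (Fn k) l → Fn k
encVF []       = litF 0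
encVF (A ∷ As) = pairF A (encVF As)

fun-encVF : (As : Vec (Fn k) l) (v : Vec ℕ k) → fun (encVF As) v ≡ encV (map (λ A → fun A v) As)
fun-encVF []       v = refl
fun-encVF (A ∷ As) v = cong (pair (fun A v)) (fun-encVF As v)

atomF : Atom k → Fn k
atomF (t !F As) = pairF (litF t) (encVF As)

infix 3 ∀[_]_,_⊢_

record Schema : Set where
  constructor ∀[_]_,_⊢_
  field
    arguments               : ℕ
    premise₁ premise₂ claim : Atom arguments

open Schema

toRule : Schema → Rule
toRule S = record
  { vars = arguments S ; prem₁ = atomF (premise₁ S) ; prem₂ = atomF (premise₂ S) ; concl = atomF (claim S) }

v₀ : Fn (1 + k)
v₀ = varF zero
v₁ : Fn (2 + k)
v₁ = varF (suc zero)
v₂ : Fn (3 + k)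
v₂ = varF (suc (suc zero))
v₃ : Fn (4 + k)
v₃ = varF (suc (suc (suc zero)))
v₄ : Fn (5 + k)
v₄ = varF (suc (suc (suc (suc zero))))
v₅ : Fn (6 + k)
v₅ = varF (suc (suc (suc (suc (suc zero)))))
v₆ : Fn (7 + k)
v₆ = varF (suc (suc (suc (suc (suc (suc zero))))))
v₇ : Fn (8 + k)
v₇ = varF (suc (suc (suc (suc (suc (suc (suc zero)))))))

axiom : ∀ k → Atom k → Schema
axiom k C = ∀[ k ] 0 !F [] , 0 !F [] ⊢ C

infer : ∀ k → Atom k → Atom k → Schema
infer k P C = ∀[ k ] P , 0 !F [] ⊢ C

pattern fuel₀  = 0
pattern zer-r  = 1
pattern succ-r = 2
pattern succ₀  = 3
pattern succ₂  = 4
pattern proj₀  = 5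
pattern proj-r = 6
pattern comp-r = 7
pattern prec₀  = 8
pattern precZ  = 9
pattern precS  = 10
pattern mu-r   = 11
pattern junk   = 12
pattern vec[]  = 13
pattern vec∷   = 14
pattern here-r = 15
pattern next-r = 16
pattern last-r = 17
pattern head-r = 18
pattern tail-r = 19
pattern gen-r  = 20
-- Literals above 20 are refused in patterns.
pattern 20+ r = suc (suc (suc (suc (suc (suc (suc (suc (suc (suc (suc (suc (suc (suc (suc (suc (suc (suc (suc (suc r)))))))))))))))))))

pattern refl-r = 20+ 1
pattern sym-r  = 20+ 2
pattern trans-r = 20+ 3
pattern cong-r = 20+ 4
pattern assoc-r = 20+ 5
pattern comm-r = 20+ 6
pattern idˡ-r  = 20+ 7
pattern idʳ-r  = 20+ 8
pattern num-r  = 20+ 9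
pattern img-var = 20+ 10
pattern img-ε  = 20+ 11
pattern img-·  = 20+ 12
pattern img-~  = 20+ 13
pattern eq-r   = 20+ 14
pattern rel[]  = 20+ 15
pattern rel∷   = 20+ 16
pattern span₀  = 20+ 17
pattern spanS  = 20+ 18
pattern event-r = 20+ 19
pattern mem-D  = 20+ 20
pattern mem-b  = 20+ (20+ 1)

-- The rules are numbered from 0 to `mem-b`, which is 41.
ruleCount : ℕ
ruleCount = 42

-- The Horn system for evaluation, congruence and the event

module System (m : ℕ) (D : Maybe ℕ) (b : ℕ) where

  n : ℕ
  n = suc m

  infixl 7 _·F_
  _·F_ : Fn k → Fn k → Fn k
  A ·F B = litF (suc n) +F pairF A B

  memD : Maybe ℕ → Schema
  memD (just y) = axiom 1 (MEM !F v₀ ∷ litF y ∷ [])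
  memD nothing  = axiom 0 (0 !F [])

  -- The rules up to `tail-r` follow `decodePR` clause by clause, with fuel and ill-formed codes
  -- included, because `W e` has to be enumerated for arbitrary e and not only for values of
  -- `encode`.
  schema : ℕ → Schema
  schema fuel₀  = axiom 3 (EV !F litF 0 ∷ v₀ ∷ v₁ ∷ v₂ ∷ litF 0 ∷ [])
  schema zer-r  = axiom 4 (EV !F sucF v₀ ∷ v₁ ∷ pairF (litF 0) v₂ ∷ v₃ ∷ litF 0 ∷ [])
  schema succ-r = axiom 4 (EV !F sucF v₀ ∷ litF 1 ∷ pairF (litF 1) v₁ ∷ pairF v₂ v₃ ∷ sucF v₂ ∷ [])
  schema succ₀  = axiom 3 (EV !F sucF v₀ ∷ litF 0 ∷ pairF (litF 1) v₁ ∷ v₂ ∷ litF 0 ∷ [])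
  schema succ₂  = axiom 4 (EV !F sucF v₀ ∷ sucF (sucF v₁) ∷ pairF (litF 1) v₂ ∷ v₃ ∷ litF 0 ∷ [])
  schema proj₀  = axiom 3 (EV !F sucF v₀ ∷ litF 0 ∷ pairF (litF 2) v₁ ∷ v₂ ∷ litF 0 ∷ [])
  schema proj-r = infer 5 (LK !F v₀ ∷ v₁ ∷ v₂ ∷ v₃ ∷ [])
                        (EV !F sucF v₄ ∷ sucF v₀ ∷ pairF (litF 2) v₁ ∷ v₂ ∷ v₃ ∷ [])
  schema comp-r = ∀[ 8 ] EVV !F v₀ ∷ v₁ ∷ v₂ ∷ v₄ ∷ v₅ ∷ v₆ ∷ [] , EV !F v₀ ∷ v₂ ∷ v₃ ∷ v₆ ∷ v₇ ∷ []
                     ⊢ (EV !F sucF v₀ ∷ v₁ ∷ pairF (litF 3) (pairF v₂ (pairF v₃ v₄)) ∷ v₅ ∷ v₇ ∷ [])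
  schema prec₀  = axiom 3 (EV !F sucF v₀ ∷ litF 0 ∷ pairF (litF 4) v₁ ∷ v₂ ∷ litF 0 ∷ [])
  schema precZ  = infer 6 (EV !F v₀ ∷ v₁ ∷ v₂ ∷ v₄ ∷ v₅ ∷ [])
                        (EV !F sucF v₀ ∷ sucF v₁ ∷ pairF (litF 4) (pairF v₂ v₃) ∷ pairF (litF 0) v₄ ∷ v₅ ∷ [])
  schema precS  = ∀[ 8 ] EV !F sucF v₀ ∷ sucF v₁ ∷ pairF (litF 4) (pairF v₂ v₃) ∷ pairF v₄ v₅ ∷ v₆ ∷ []
                     , EV !F v₀ ∷ sucF (sucF v₁) ∷ v₃ ∷ pairF v₄ (pairF v₆ v₅) ∷ v₇ ∷ []
                     ⊢ (EV !F sucF v₀ ∷ sucF v₁ ∷ pairF (litF 4) (pairF v₂ v₃) ∷ pairF (sucF v₄) v₅ ∷ v₇ ∷ [])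
  schema mu-r   = infer 5 (MU !F v₀ ∷ v₁ ∷ v₂ ∷ v₃ ∷ litF 0 ∷ v₄ ∷ [])
                        (EV !F sucF v₀ ∷ v₁ ∷ pairF (litF 5) v₂ ∷ v₃ ∷ v₄ ∷ [])
  schema junk   = axiom 5 (EV !F sucF v₀ ∷ v₁ ∷ pairF (litF 6 +F v₂) v₃ ∷ v₄ ∷ litF 0 ∷ [])
  schema vec[]  = axiom 4 (EVV !F v₀ ∷ v₁ ∷ litF 0 ∷ v₂ ∷ v₃ ∷ litF 0 ∷ [])
  schema vec∷   = ∀[ 8 ] EV !F v₀ ∷ v₁ ∷ v₃ ∷ v₅ ∷ v₆ ∷ [] , EVV !F v₀ ∷ v₁ ∷ v₂ ∷ v₄ ∷ v₅ ∷ v₇ ∷ []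
                     ⊢ (EVV !F v₀ ∷ v₁ ∷ sucF v₂ ∷ pairF v₃ v₄ ∷ v₅ ∷ pairF v₆ v₇ ∷ [])
  schema here-r = infer 5 (EV !F v₀ ∷ sucF v₁ ∷ v₂ ∷ pairF v₄ v₃ ∷ litF 0 ∷ [])
                        (MU !F v₀ ∷ v₁ ∷ v₂ ∷ v₃ ∷ v₄ ∷ v₄ ∷ [])
  schema next-r = ∀[ 7 ] EV !F v₀ ∷ sucF v₁ ∷ v₂ ∷ pairF v₄ v₃ ∷ sucF v₅ ∷ []
                     , MU !F v₀ ∷ v₁ ∷ v₂ ∷ v₃ ∷ sucF v₄ ∷ v₆ ∷ []
                     ⊢ (MU !F v₀ ∷ v₁ ∷ v₂ ∷ v₃ ∷ v₄ ∷ v₆ ∷ [])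
  schema last-r = axiom 3 (LK !F litF 0 ∷ v₀ ∷ pairF v₁ v₂ ∷ v₁ ∷ [])
  schema head-r = axiom 3 (LK !F sucF v₀ ∷ litF 0 ∷ pairF v₁ v₂ ∷ v₁ ∷ [])
  schema tail-r = infer 5 (LK !F v₀ ∷ v₁ ∷ v₂ ∷ v₃ ∷ [])
                        (LK !F sucF v₀ ∷ sucF v₁ ∷ pairF v₄ v₂ ∷ v₃ ∷ [])
  -- `φ e` is e decoded at arity 1 with fuel `suc e`; its argument is the code of the pair of terms.
  schema gen-r  = infer 4 (EV !F sucF v₀ ∷ litF 1 ∷ v₀ ∷ pairF (pairF v₁ v₂) (litF 0) ∷ v₃ ∷ [])
                        (CG !F v₀ ∷ v₁ ∷ v₂ ∷ [])
  schema refl-r = axiom 2 (CG !F v₀ ∷ v₁ ∷ v₁ ∷ [])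
  schema sym-r  = infer 3 (CG !F v₀ ∷ v₁ ∷ v₂ ∷ []) (CG !F v₀ ∷ v₂ ∷ v₁ ∷ [])
  schema trans-r = ∀[ 4 ] CG !F v₀ ∷ v₁ ∷ v₂ ∷ [] , CG !F v₀ ∷ v₂ ∷ v₃ ∷ [] ⊢ (CG !F v₀ ∷ v₁ ∷ v₃ ∷ [])
  schema cong-r = ∀[ 5 ] CG !F v₀ ∷ v₁ ∷ v₂ ∷ [] , CG !F v₀ ∷ v₃ ∷ v₄ ∷ []
                     ⊢ (CG !F v₀ ∷ (v₁ ·F v₃) ∷ (v₂ ·F v₄) ∷ [])
  schema assoc-r = axiom 4 (CG !F v₀ ∷ (v₁ ·F v₂) ·F v₃ ∷ v₁ ·F (v₂ ·F v₃) ∷ [])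
  schema comm-r = axiom 3 (CG !F v₀ ∷ (v₁ ·F v₂) ∷ (v₂ ·F v₁) ∷ [])
  schema idˡ-r  = axiom 2 (CG !F v₀ ∷ (litF n ·F v₁) ∷ v₁ ∷ [])
  schema idʳ-r  = axiom 2 (CG !F v₀ ∷ (v₁ ·F litF n) ∷ v₁ ∷ [])
  schema num-r  = axiom 0 (NUM !F litF n ∷ [])
  -- The first premise says that v₀ < n.
  schema img-var = ∀[ 5 ] NUM !F v₀ +F sucF v₁ ∷ [] , LK !F litF m ∷ v₀ ∷ v₂ ∷ v₃ ∷ []
                     ⊢ (IMG !F v₄ ∷ v₂ ∷ v₀ ∷ v₃ ∷ [])
  schema img-ε  = axiom 2 (IMG !F v₀ ∷ v₁ ∷ litF n ∷ litF n ∷ [])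
  schema img-·  = ∀[ 6 ] IMG !F v₀ ∷ v₁ ∷ v₂ ∷ v₃ ∷ [] , IMG !F v₀ ∷ v₁ ∷ v₄ ∷ v₅ ∷ []
                     ⊢ (IMG !F v₀ ∷ v₁ ∷ v₂ ·F v₄ ∷ v₃ ·F v₅ ∷ [])
  schema img-~  = ∀[ 5 ] IMG !F v₀ ∷ v₁ ∷ v₂ ∷ v₃ ∷ [] , CG !F v₀ ∷ v₃ ∷ v₄ ∷ []
                     ⊢ (IMG !F v₀ ∷ v₁ ∷ v₂ ∷ v₄ ∷ [])
  schema eq-r   = ∀[ 5 ] IMG !F v₀ ∷ v₁ ∷ v₂ ∷ v₄ ∷ [] , IMG !F v₀ ∷ v₁ ∷ v₃ ∷ v₄ ∷ []
                     ⊢ (EQ !F v₀ ∷ v₁ ∷ v₂ ∷ v₃ ∷ [])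
  schema rel[]  = axiom 3 (REL !F v₀ ∷ v₁ ∷ litF 0 ∷ v₂ ∷ [])
  schema rel∷   = ∀[ 6 ] EQ !F v₀ ∷ v₁ ∷ v₂ ∷ v₃ ∷ [] , REL !F v₀ ∷ v₁ ∷ v₄ ∷ v₅ ∷ []
                     ⊢ (REL !F v₀ ∷ v₁ ∷ sucF v₄ ∷ pairF (pairF v₂ v₃) v₅ ∷ [])
  schema span₀  = axiom 2 (SP !F v₀ ∷ v₁ ∷ litF 0 ∷ [])
  -- The code of the generator x_j is j itself, so v₂ is both the counter and the term to be
  -- reached; v₃ is a preimage of it.
  schema spanS  = ∀[ 4 ] IMG !F v₀ ∷ v₁ ∷ v₃ ∷ v₂ ∷ [] , SP !F v₀ ∷ v₁ ∷ v₂ ∷ []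
                     ⊢ (SP !F v₀ ∷ v₁ ∷ sucF v₂ ∷ [])
  schema event-r = ∀[ 4 ] REL !F v₀ ∷ v₁ ∷ v₂ ∷ v₃ ∷ [] , SP !F v₀ ∷ v₁ ∷ litF n ∷ []
                     ⊢ (EVT !F v₀ ∷ v₂ ∷ v₃ ∷ [])
  schema mem-D  = memD D
  -- The element b appears once `φ c` halts on its own index c.
  schema mem-b  = infer 2 (EV !F sucF v₀ ∷ litF 1 ∷ v₀ ∷ pairF v₀ (litF 0) ∷ v₁ ∷ [])
                        (MEM !F v₀ ∷ litF b ∷ [])
  schema _      = axiom 0 (0 !F [])

  open Horn (λ r → toRule (schema r)) ruleCount public

  -- Meaning of the judgements and soundness of the rules

  images : ℕ → Fin n → Term n
  images g i = termOf n (lookup (decV n g) i)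

  infix 4 _⊨_~_

  _⊨_~_ : ℕ → Term n → Term n → Set
  e ⊨ s ~ t = Cong (Gen n e) s t

  Relations : ∀ {l} → ℕ → (Fin n → Term n) → Vec ℕ l → Set
  Relations e σ = VecAll.All (λ p → e ⊨ sub σ (termOf n (π₁ p)) ~ sub σ (termOf n (π₂ p)))

  SpanUpTo : ℕ → (Fin n → Term n) → ℕ → Set
  SpanUpTo e σ j = ∀ i → toℕ i < j → ∃ λ w → e ⊨ sub σ w ~ var i

  Sem : (t : ℕ) → Vec ℕ (arity t) → Set
  Sem EV  (f ∷ k ∷ e ∷ xs ∷ y ∷ [])      = Eval (decodePR f k e) (decV k xs) y
  Sem EVV (f ∷ k ∷ l ∷ e ∷ xs ∷ ys ∷ []) = EvalVec (decodeVecPR f k l e) (decV k xs) (decV l ys)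
  Sem MU  (f ∷ k ∷ e ∷ xs ∷ z ∷ y ∷ [])  = MuFrom (decodePR f (suc k) e) (decV k xs) z y
  Sem LK  (k ∷ r ∷ xs ∷ y ∷ [])          = lookup (decV (suc k) xs) (toFin k r) ≡ y
  Sem CG  (e ∷ s ∷ t ∷ [])               = e ⊨ termOf n s ~ termOf n t
  Sem NUM (x ∷ [])                       = x ≡ n
  Sem IMG (e ∷ g ∷ s ∷ t ∷ [])           = e ⊨ sub (images g) (termOf n s) ~ termOf n t
  Sem EQ  (e ∷ g ∷ s ∷ t ∷ [])           = e ⊨ sub (images g) (termOf n s) ~ sub (images g) (termOf n t)
  Sem REL (e ∷ g ∷ l ∷ c ∷ [])           = Relations e (images g) (decV l c)
  Sem SP  (e ∷ g ∷ j ∷ [])               = SpanUpTo e (images g) j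
  Sem EVT (e ∷ l ∷ c ∷ [])               = ∃ λ σ → Relations e σ (decV l c) × SpanUpTo e σ n
  Sem MEM (c ∷ x ∷ [])                   = D ≡ just x ⊎ (x ≡ b × W c c)
  Sem _   _                              = ⊤

  data True (j : ℕ) : Set where
    true-sem : Sem (π₁ j) (decV (arity (π₁ j)) (π₂ j)) → True j

  arg⇒ : ∀ k x c {p : PR (suc k)} {y} → Eval p (decV (suc k) (pair x c)) y → Eval p (x ∷ decV k c) y
  arg⇒ k x c {p} {y} = subst (λ v → Eval p v y) (decV-∷ k x c)

  arg⇐ : ∀ k x c {p : PR (suc k)} {y} → Eval p (x ∷ decV k c) y → Eval p (decV (suc k) (pair x c)) y
  arg⇐ k x c {p} {y} = subst (λ v → Eval p v y) (sym (decV-∷ k x c))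

  coded : ∀ {e s s′ t t′} → s ≡ s′ → t ≡ t′ → e ⊨ s′ ~ t′ → e ⊨ s ~ t
  coded refl refl x = x

  Sem-! : ∀ t v → Sem (π₁ (t ! v)) (decV (arity (π₁ (t ! v))) (π₂ (t ! v))) ≡ Sem t v
  Sem-! t v rewrite unpair-pair t (encV v) | decV-encV v = refl

  SemAtom : Atom k → Vec ℕ k → Set
  SemAtom (t !F As) v = Sem t (map (λ A → fun A v) As)

  True-atom : ∀ (A : Atom k) v → True (fun (atomF A) v) ⇔ SemAtom A v
  True-atom (t !F As) v = mk⇔
    (λ { (true-sem x) → subst id (Sem-! t u) (subst Semᶜ eq x) })
    (λ x → true-sem (subst Semᶜ (sym eq) (subst id (sym (Sem-! t u)) x)))
    where
    u : Vec ℕ (arity t)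
    u = map (λ A → fun A v) As
    Semᶜ : ℕ → Set
    Semᶜ c = Sem (π₁ c) (decV (arity (π₁ c)) (π₂ c))
    eq : fun (atomF (t !F As)) v ≡ (t ! u)
    eq = cong (pair t) (fun-encVF As v)

  schema-sound : ∀ r v → SemAtom (premise₁ (schema r)) v → SemAtom (premise₂ (schema r)) v →
                 SemAtom (claim (schema r)) v
  schema-sound fuel₀ v _ _ = ev-zer
  schema-sound zer-r (f ∷ k ∷ r ∷ xs ∷ []) _ _ = ≡⇐ (decode-zer f k r) ev-zer
  schema-sound succ-r (f ∷ r ∷ x ∷ xs ∷ []) _ _ =
    ≡⇐ (decode-succ f r) (subst (λ z → Eval succ (z ∷ []) (suc x)) (sym (π₁-pair x xs)) ev-succ)
  schema-sound succ₀ (f ∷ r ∷ xs ∷ []) _ _ = ≡⇐ (decode-succ₀ f r) ev-zer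
  schema-sound succ₂ (f ∷ k ∷ r ∷ xs ∷ []) _ _ = ≡⇐ (decode-succ₂ f k r) ev-zer
  schema-sound proj₀ (f ∷ r ∷ xs ∷ []) _ _ = ≡⇐ (decode-proj₀ f r) ev-zer
  schema-sound proj-r (k ∷ r ∷ xs ∷ y ∷ f ∷ []) x _ =
    ≡⇐ (decode-proj f k r) (subst (Eval _ _) x ev-proj)
  schema-sound comp-r (f ∷ k ∷ m ∷ a ∷ b ∷ xs ∷ ys ∷ y ∷ []) x z =
    ≡⇐ (decode-comp f k m a b) (ev-comp x z)
  schema-sound prec₀ (f ∷ r ∷ xs ∷ []) _ _ = ≡⇐ (decode-prec₀ f r) ev-zer
  schema-sound precZ (f ∷ k ∷ a ∷ b ∷ xs ∷ y ∷ []) x _ =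
    ≡⇐ (decode-prec f k a b) (arg⇐ k 0 xs (ev-prec0 x))
  schema-sound precS (f ∷ k ∷ a ∷ b ∷ i ∷ xs ∷ z ∷ y ∷ []) x x′ =
    ≡⇐ (decode-prec f k a b) (arg⇐ k (suc i) xs (ev-precS
      (arg⇒ k i xs (≡⇒ (decode-prec f k a b) x))
      (subst (λ v → Eval (decodePR f (2 + k) b) (i ∷ v) y) (decV-∷ k z xs) (arg⇒ (suc k) i (pair z xs) x′))))
  schema-sound mu-r (f ∷ k ∷ r ∷ xs ∷ y ∷ []) x _ = ≡⇐ (decode-mu f k r) (ev-mu x)
  schema-sound junk (f ∷ k ∷ t ∷ r ∷ xs ∷ []) _ _ = ≡⇐ (decode-junk f k t r) ev-zer
  schema-sound vec[] v _ _ = []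
  schema-sound vec∷ (f ∷ k ∷ l ∷ a ∷ b ∷ xs ∷ y ∷ ys ∷ []) x z =
    subst (λ ps → EvalVec ps (decV k xs) (decV (suc l) (pair y ys))) (sym (decodeVec-∷ f k l a b))
      (subst (EvalVec _ _) (sym (decV-∷ l y ys)) (x ∷ z))
  schema-sound here-r (f ∷ k ∷ r ∷ xs ∷ z ∷ []) x _ = mu-here (arg⇒ k z xs x)
  schema-sound next-r (f ∷ k ∷ r ∷ xs ∷ z ∷ v ∷ y ∷ []) x s = mu-next (arg⇒ k z xs x) s
  schema-sound last-r (r ∷ x ∷ xs ∷ []) _ _ = π₁-pair x xs
  schema-sound head-r (k ∷ x ∷ xs ∷ []) _ _ = π₁-pair x xs
  schema-sound tail-r (k ∷ r ∷ xs ∷ y ∷ x ∷ []) p _ =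
    trans (cong (λ c → lookup (decV (suc k) c) (toFin k r)) (π₂-pair x xs)) p
  schema-sound gen-r (e ∷ s ∷ t ∷ y ∷ []) x _ =
    gen (pair s t , (y , subst (λ z → Eval (φ e) (z ∷ []) y) (π₁-pair (pair s t) 0) x) ,
         cong₂ (λ a b → termOf n a , termOf n b) (π₁-pair s t) (π₂-pair s t))
  schema-sound refl-r v _ _ = ~refl
  schema-sound sym-r (e ∷ s ∷ t ∷ []) x _ = ~sym x
  schema-sound trans-r (e ∷ s ∷ t ∷ u ∷ []) x y = ~trans x y
  schema-sound cong-r (e ∷ s ∷ s′ ∷ t ∷ t′ ∷ []) x y =
    coded (termOf-· m s t) (termOf-· m s′ t′) (·-cong x y)
  schema-sound assoc-r (e ∷ s ∷ t ∷ u ∷ []) _ _ =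
    coded (trans (termOf-· m _ u) (cong (_· _) (termOf-· m s t)))
          (trans (termOf-· m s _) (cong (_ ·_) (termOf-· m t u))) ~assoc
  schema-sound comm-r (e ∷ s ∷ t ∷ []) _ _ = coded (termOf-· m s t) (termOf-· m t s) ~comm
  schema-sound idˡ-r (e ∷ s ∷ []) _ _ =
    coded (trans (termOf-· m n s) (cong (_· termOf n s) (termOf-ε m))) refl idˡ
  schema-sound idʳ-r (e ∷ s ∷ []) _ _ =
    coded (trans (termOf-· m s n) (cong (termOf n s ·_) (termOf-ε m))) refl idʳ
  schema-sound num-r v _ _ = refl
  schema-sound img-var (i ∷ j ∷ g ∷ a ∷ e ∷ []) eq p = ≡⇒~ (trans
    (cong (sub (images g)) (termOf-var m i<n))
    (cong (termOf n) (trans (cong (lookup (decV n g)) (sym toFin-i)) p)))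
    where
    i<n : i < n
    i<n = subst (i <_) eq (m<m+n i (s≤s z≤n))
    toFin-i : toFin m i ≡ fromℕ< i<n
    toFin-i = trans (cong (toFin m) (sym (toℕ-fromℕ< i<n))) (toFin-toℕ (fromℕ< i<n))
  schema-sound img-ε (e ∷ g ∷ []) _ _ =
    ≡⇒~ (trans (cong (sub (images g)) (termOf-ε m)) (sym (termOf-ε m)))
  schema-sound img-· (e ∷ g ∷ s ∷ a ∷ t ∷ b ∷ []) x y =
    coded (cong (sub (images g)) (termOf-· m s t)) (termOf-· m a b) (·-cong x y)
  schema-sound img-~ (e ∷ g ∷ s ∷ a ∷ b ∷ []) x y = ~trans x y
  schema-sound eq-r (e ∷ g ∷ s ∷ t ∷ a ∷ []) x y = ~trans x (~sym y)
  schema-sound rel[] v _ _ = []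
  schema-sound rel∷ (e ∷ g ∷ s ∷ t ∷ l ∷ c ∷ []) x y =
    subst (Relations e (images g)) (sym (decV-∷ l (pair s t) c))
      (coded (cong (sub (images g) ∘ termOf n) (π₁-pair s t))
             (cong (sub (images g) ∘ termOf n) (π₂-pair s t)) x ∷ y)
  schema-sound span₀ v _ _ i ()
  schema-sound spanS (e ∷ g ∷ j ∷ w ∷ []) x y i (s≤s i≤j) with m≤n⇒m<n∨m≡n i≤j
  ... | inj₁ i<j  = y i i<j
  ... | inj₂ refl = termOf n w , ~trans x (≡⇒~ (termOf-encodeTerm m (var i)))
  schema-sound event-r (e ∷ g ∷ l ∷ c ∷ []) x y = images g , x , y
  schema-sound mem-D = mem-D-sound D refl
    where
    mem-D-sound : ∀ E → D ≡ E → ∀ v → SemAtom (premise₁ (memD E)) v → SemAtom (premise₂ (memD E)) v →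
                  SemAtom (claim (memD E)) v
    mem-D-sound (just y) eq (c ∷ []) _ _ = inj₁ eq
    mem-D-sound nothing  eq v _ _ = tt
  schema-sound mem-b (c ∷ y ∷ []) x _ =
    inj₂ (refl , y , subst (λ z → Eval (φ c) (z ∷ []) y) (π₁-pair c 0) x)
  schema-sound (20+ (20+ (suc (suc _)))) v _ _ = tt

  Der-sound : ∀ {j} → Der j → True j
  Der-sound base = true-sem tt
  Der-sound (by r v x y) = from (True-atom (claim (schema r)) v)
    (schema-sound r v (to (True-atom (premise₁ (schema r)) v) (Der-sound x))
                      (to (True-atom (premise₂ (schema r)) v) (Der-sound y)))

  sound : ∀ t v → Der (t ! v) → Sem t v
  sound t v x with Der-sound x
  ... | true-sem y = subst id (Sem-! t v) y

  -- Completeness of the Horn system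

  triv : Der (pair 0 0)
  triv = subst Der (sym pair-zero) base

  complete-LK : ∀ k r xs → Der (LK ! k ∷ r ∷ encV xs ∷ lookup xs (toFin k r) ∷ [])
  complete-LK zero    r       (x ∷ xs) = by last-r (r ∷ x ∷ encV xs ∷ []) triv triv
  complete-LK (suc k) zero    (x ∷ xs) = by head-r (k ∷ x ∷ encV xs ∷ []) triv triv
  complete-LK (suc k) (suc r) (x ∷ xs) =
    by tail-r (k ∷ r ∷ encV xs ∷ lookup xs (toFin k r) ∷ x ∷ []) (complete-LK k r xs) triv

  mutual
    -- Recursion on the evaluation, after e is rewritten as a pair of tag and payload so that the
    -- clauses of `decodePR` apply.
    complete-EV : ∀ f k e {xs y} → Eval (decodePR f k e) xs y → Der (EV ! f ∷ k ∷ e ∷ encV xs ∷ y ∷ [])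
    complete-EV zero k e {xs} ev-zer = by fuel₀ (k ∷ e ∷ encV xs ∷ []) triv triv
    complete-EV (suc f) k e {xs} {y} x =
      subst (λ c → Der (EV ! suc f ∷ k ∷ c ∷ encV xs ∷ y ∷ [])) (pair-unpair e)
        (complete-tagged f k (π₁ e) (π₂ e)
          (≡⇐ (cong (decodePR (suc f) k) (pair-unpair e)) x))

    complete-tagged : ∀ f k t r {xs y} → Eval (decodePR (suc f) k (pair t r)) xs y →
                      Der (EV ! suc f ∷ k ∷ pair t r ∷ encV xs ∷ y ∷ [])
    complete-tagged f k 0 r {xs} x with ≡⇒ (decode-zer f k r) x
    ... | ev-zer = by zer-r (f ∷ k ∷ r ∷ encV xs ∷ []) triv triv
    complete-tagged f 0 1 r {[]} x with ≡⇒ (decode-succ₀ f r) x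
    ... | ev-zer = by succ₀ (f ∷ r ∷ 0 ∷ []) triv triv
    complete-tagged f 1 1 r x with ≡⇒ (decode-succ f r) x
    ... | ev-succ = by succ-r (f ∷ r ∷ _ ∷ 0 ∷ []) triv triv
    complete-tagged f (suc (suc k)) 1 r {xs} x with ≡⇒ (decode-succ₂ f k r) x
    ... | ev-zer = by succ₂ (f ∷ k ∷ r ∷ encV xs ∷ []) triv triv
    complete-tagged f 0 2 r {[]} x with ≡⇒ (decode-proj₀ f r) x
    ... | ev-zer = by proj₀ (f ∷ r ∷ 0 ∷ []) triv triv
    complete-tagged f (suc k) 2 r {xs} x with ≡⇒ (decode-proj f k r) x
    ... | ev-proj = by proj-r (k ∷ r ∷ encV xs ∷ _ ∷ f ∷ []) (complete-LK k r xs) triv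
    complete-tagged f k 3 r {xs} {y} x =
      subst (λ c → Der (EV ! suc f ∷ k ∷ pair 3 c ∷ encV xs ∷ y ∷ [])) eq (go (≡⇒ (trans
        (cong (λ c → decodePR (suc f) k (pair 3 c)) (sym eq)) (decode-comp f k j p q)) x))
      where
      j p q : ℕ
      j = π₁ r
      p = π₁ (π₂ r)
      q = π₂ (π₂ r)
      eq : pair j (pair p q) ≡ r
      eq = trans (cong (pair j) (pair-unpair (π₂ r))) (pair-unpair r)
      go : Eval (comp (decodePR f j p) (decodeVecPR f k j q)) xs y →
           Der (EV ! suc f ∷ k ∷ pair 3 (pair j (pair p q)) ∷ encV xs ∷ y ∷ [])
      go (ev-comp {ys = ys} gs g) = by comp-r (f ∷ k ∷ j ∷ p ∷ q ∷ encV xs ∷ encV ys ∷ y ∷ [])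
        (complete-EVV f k j q gs) (complete-EV f j p g)
    complete-tagged f 0 4 r {[]} x with ≡⇒ (decode-prec₀ f r) x
    ... | ev-zer = by prec₀ (f ∷ r ∷ 0 ∷ []) triv triv
    complete-tagged f (suc k) 4 r {xs} {y} x =
      subst (λ c → Der (EV ! suc f ∷ suc k ∷ pair 4 c ∷ encV xs ∷ y ∷ [])) (pair-unpair r)
        (complete-prec f k (π₁ r) (π₂ r) (≡⇒ (trans
          (cong (λ c → decodePR (suc f) (suc k) (pair 4 c)) (sym (pair-unpair r)))
          (decode-prec f k (π₁ r) (π₂ r))) x))
    complete-tagged f k 5 r {xs} {y} x with ≡⇒ (decode-mu f k r) x
    ... | ev-mu s = by mu-r (f ∷ k ∷ r ∷ encV xs ∷ y ∷ []) (complete-MU f k r s) triv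
    complete-tagged f k (suc (suc (suc (suc (suc (suc t)))))) r {xs} x with ≡⇒ (decode-junk f k t r) x
    ... | ev-zer = by junk (f ∷ k ∷ t ∷ r ∷ encV xs ∷ []) triv triv

    complete-prec : ∀ f k a b {xs y} →
                    Eval (prec (decodePR f k a) (decodePR f (suc (suc k)) b)) xs y →
                    Der (EV ! suc f ∷ suc k ∷ pair 4 (pair a b) ∷ encV xs ∷ y ∷ [])
    complete-prec f k a b {y = y} (ev-prec0 {xs = xs} x) =
      by precZ (f ∷ k ∷ a ∷ b ∷ encV xs ∷ y ∷ []) (complete-EV f k a x) triv
    complete-prec f k a b {y = y} (ev-precS {xs = xs} {n = i} {z = z} x x′) =
      by precS (f ∷ k ∷ a ∷ b ∷ i ∷ encV xs ∷ z ∷ y ∷ [])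
        (complete-prec f k a b x) (complete-EV f (suc (suc k)) b x′)

    complete-EVV : ∀ f k l b {xs ys} → EvalVec (decodeVecPR f k l b) xs ys →
                   Der (EVV ! f ∷ k ∷ l ∷ b ∷ encV xs ∷ encV ys ∷ [])
    complete-EVV f k zero b {xs} [] = by vec[] (f ∷ k ∷ b ∷ encV xs ∷ []) triv triv
    complete-EVV f k (suc l) b {xs} (_∷_ {y = y} {ys = ys} x z) =
      subst (λ c → Der (EVV ! f ∷ k ∷ suc l ∷ c ∷ encV xs ∷ pair y (encV ys) ∷ [])) (pair-unpair b)
        (by vec∷ (f ∷ k ∷ l ∷ π₁ b ∷ π₂ b ∷ encV xs ∷ y ∷ encV ys ∷ [])
          (complete-EV f k (π₁ b) x) (complete-EVV f k l (π₂ b) z))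

    complete-MU : ∀ f k r {xs z y} → MuFrom (decodePR f (suc k) r) xs z y →
                  Der (MU ! f ∷ k ∷ r ∷ encV xs ∷ z ∷ y ∷ [])
    complete-MU f k r {xs} {z} (mu-here x) =
      by here-r (f ∷ k ∷ r ∷ encV xs ∷ z ∷ []) (complete-EV f (suc k) r x) triv
    complete-MU f k r {xs} {z} {y} (mu-next {v = v} x s) =
      by next-r (f ∷ k ∷ r ∷ encV xs ∷ z ∷ v ∷ y ∷ [])
        (complete-EV f (suc k) r x) (complete-MU f k r s)

  complete-W : ∀ {e x} → W e x → ∃ λ y → Der (EV ! suc e ∷ 1 ∷ e ∷ pair x 0 ∷ y ∷ [])
  complete-W {e} (y , x) = y , complete-EV (suc e) 1 e x

  ⌜_⌝ : Term n → ℕ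
  ⌜_⌝ = encodeTerm

  complete-CG : ∀ {e s t} → e ⊨ s ~ t → Der (CG ! e ∷ ⌜ s ⌝ ∷ ⌜ t ⌝ ∷ [])
  complete-CG {e} (gen (p , w , refl)) with complete-W {e} {p} w
  -- Every term has exactly one code, so the two halves of p are the canonical codes of the two
  -- sides.
  ... | y , x = subst₂ (λ a b → Der (CG ! e ∷ a ∷ b ∷ []))
    (sym (encodeTerm-termOf m (π₁ p))) (sym (encodeTerm-termOf m (π₂ p)))
    (by gen-r (e ∷ π₁ p ∷ π₂ p ∷ y ∷ [])
      (subst (λ c → Der (EV ! suc e ∷ 1 ∷ e ∷ pair c 0 ∷ y ∷ [])) (sym (pair-unpair p)) x) triv)
  complete-CG {e} {s} ~refl = by refl-r (e ∷ ⌜ s ⌝ ∷ []) triv triv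
  complete-CG {e} {s} {t} (~sym x) = by sym-r (e ∷ ⌜ t ⌝ ∷ ⌜ s ⌝ ∷ []) (complete-CG x) triv
  complete-CG {e} {s} {u} (~trans {t = t} x y) =
    by trans-r (e ∷ ⌜ s ⌝ ∷ ⌜ t ⌝ ∷ ⌜ u ⌝ ∷ []) (complete-CG x) (complete-CG y)
  complete-CG {e} (·-cong {s} {s′} {t} {t′} x y) =
    by cong-r (e ∷ ⌜ s ⌝ ∷ ⌜ s′ ⌝ ∷ ⌜ t ⌝ ∷ ⌜ t′ ⌝ ∷ []) (complete-CG x) (complete-CG y)
  complete-CG {e} (~assoc {s} {t} {u}) = by assoc-r (e ∷ ⌜ s ⌝ ∷ ⌜ t ⌝ ∷ ⌜ u ⌝ ∷ []) triv triv
  complete-CG {e} (~comm {s} {t}) = by comm-r (e ∷ ⌜ s ⌝ ∷ ⌜ t ⌝ ∷ []) triv triv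
  complete-CG {e} (idˡ {s}) = by idˡ-r (e ∷ ⌜ s ⌝ ∷ []) triv triv
  complete-CG {e} (idʳ {s}) = by idʳ-r (e ∷ ⌜ s ⌝ ∷ []) triv triv

  imageCode : (Fin n → Term n) → ℕ
  imageCode σ = encV (tabulate (λ i → ⌜ σ i ⌝))

  complete-IMG : ∀ e σ s → Der (IMG ! e ∷ imageCode σ ∷ ⌜ s ⌝ ∷ ⌜ sub σ s ⌝ ∷ [])
  complete-IMG e σ (var i) = by img-var (toℕ i ∷ n ∸ suc (toℕ i) ∷ imageCode σ ∷ ⌜ σ i ⌝ ∷ e ∷ [])
    (subst (λ x → Der (NUM ! x ∷ []))
      (trans (sym (m+[n∸m]≡n (toℕ<n i))) (sym (+-suc (toℕ i) (n ∸ suc (toℕ i)))))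
      (by num-r [] triv triv))
    (subst (λ a → Der (LK ! m ∷ toℕ i ∷ imageCode σ ∷ a ∷ []))
      (trans (cong (lookup (tabulate (λ j → ⌜ σ j ⌝))) (toFin-toℕ i)) (lookup∘tabulate (λ j → ⌜ σ j ⌝) i))
      (complete-LK m (toℕ i) (tabulate (λ j → ⌜ σ j ⌝))))
  complete-IMG e σ ε       = by img-ε (e ∷ imageCode σ ∷ []) triv triv
  complete-IMG e σ (s · t) =
    by img-· (e ∷ imageCode σ ∷ ⌜ s ⌝ ∷ ⌜ sub σ s ⌝ ∷ ⌜ t ⌝ ∷ ⌜ sub σ t ⌝ ∷ [])
      (complete-IMG e σ s) (complete-IMG e σ t)

  complete-IMG~ : ∀ {e} σ s {t} → e ⊨ sub σ s ~ t → Der (IMG ! e ∷ imageCode σ ∷ ⌜ s ⌝ ∷ ⌜ t ⌝ ∷ [])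
  complete-IMG~ {e} σ s {t} x =
    by img-~ (e ∷ imageCode σ ∷ ⌜ s ⌝ ∷ ⌜ sub σ s ⌝ ∷ ⌜ t ⌝ ∷ []) (complete-IMG e σ s) (complete-CG x)

  complete-REL : ∀ {l e} σ (c : Vec ℕ l) → Relations e σ c →
                 Der (REL ! e ∷ imageCode σ ∷ l ∷ encV c ∷ [])
  complete-REL {zero} {e} σ [] [] = by rel[] (e ∷ imageCode σ ∷ 0 ∷ []) triv triv
  complete-REL {suc l} {e} σ (p ∷ c) (x ∷ xs) =
    subst (λ q → Der (REL ! e ∷ imageCode σ ∷ suc l ∷ pair q (encV c) ∷ [])) (pair-unpair p)
      (by rel∷ (e ∷ imageCode σ ∷ π₁ p ∷ π₂ p ∷ l ∷ encV c ∷ [])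
        (by eq-r (e ∷ imageCode σ ∷ π₁ p ∷ π₂ p ∷ ⌜ sub σ t ⌝ ∷ [])
          (subst (λ a → Der (IMG ! e ∷ imageCode σ ∷ a ∷ ⌜ sub σ t ⌝ ∷ [])) (encodeTerm-termOf m (π₁ p))
            (complete-IMG~ σ (termOf n (π₁ p)) x))
          (subst (λ a → Der (IMG ! e ∷ imageCode σ ∷ a ∷ ⌜ sub σ t ⌝ ∷ [])) (encodeTerm-termOf m (π₂ p))
            (complete-IMG e σ t)))
        (complete-REL σ c xs))
    where
    t : Term n
    t = termOf n (π₂ p)

  complete-SP : ∀ {e} σ j → j ≤ n → SpanUpTo e σ j → Der (SP ! e ∷ imageCode σ ∷ j ∷ [])
  complete-SP {e} σ zero    _   _ = by span₀ (e ∷ imageCode σ ∷ []) triv triv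
  complete-SP {e} σ (suc j) j<n x with x (fromℕ< j<n) (s≤s (≤-reflexive (toℕ-fromℕ< j<n)))
  ... | w , eq = by spanS (e ∷ imageCode σ ∷ j ∷ ⌜ w ⌝ ∷ [])
    (subst (λ a → Der (IMG ! e ∷ imageCode σ ∷ ⌜ w ⌝ ∷ a ∷ [])) (toℕ-fromℕ< j<n) (complete-IMG~ σ w eq))
    (complete-SP σ j (<⇒≤ j<n) (λ i i<j → x i (m<n⇒m<1+n i<j)))

  complete-EVT : ∀ {l e} σ (c : Vec ℕ l) → Relations e σ c → SpanUpTo e σ n →
                 Der (EVT ! e ∷ l ∷ encV c ∷ [])
  complete-EVT {l} {e} σ c x y = by event-r (e ∷ imageCode σ ∷ l ∷ encV c ∷ [])
    (complete-REL σ c x) (complete-SP σ n ≤-refl y)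

  complete-MEM : ∀ {c x} → D ≡ just x ⊎ (x ≡ b × W c c) → Der (MEM ! c ∷ x ∷ [])
  complete-MEM {c} {x} (inj₁ eq) = mem-D-complete D eq refl
    where
    mem-D-complete : ∀ E → E ≡ just x → D ≡ E → Der (MEM ! c ∷ x ∷ [])
    mem-D-complete (just _) refl refl = by mem-D (c ∷ []) triv triv
  complete-MEM {c} (inj₂ (refl , w)) with complete-W {c} {c} w
  ... | y , x = by mem-b (c ∷ y ∷ []) x triv

-- The self-referential index

module Diagonal (m : ℕ) (D : Maybe ℕ) (b : ℕ) (h : ℕ → ℕ) (comp-h : Computable h)
                {l : ℕ} (c : Vec ℕ l) where

  open System m D b

  opaque
    hF : Fn k → Fn k
    hF = lift₁ h (record { fun = λ { (x ∷ []) → h x } ; code = proj₁ comp-h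
                         ; eval = λ { (x ∷ []) → proj₂ comp-h x } }) (λ _ → refl)

    -- The parameter k is kept as an argument here; fixing it by s-m-n makes `index` computable, so
    -- that `event` may call it.
    member : PR 2
    member = search (atomF (MEM !F v₀ ∷ v₁ ∷ []))

    index : ℕ → ℕ
    index x = encode (specialise member x)

    -- The relations c are finitely many, hence they can be built into the program as a literal.
    event : PR 1
    event = search (atomF (EVT !F hF (encode-specialiseF member v₀) ∷ litF l ∷ litF (encV c) ∷ []))

    self : ℕ
    self = encode event

    W-index : ∀ k x → W (index k) x ⇔ (D ≡ just x ⊎ (x ≡ b × W k k))
    W-index k x = mk⇔
      (λ { (y , ev) → sound MEM (k ∷ x ∷ []) (search-sound (atomF (MEM !F v₀ ∷ v₁ ∷ [])) (k ∷ x ∷ [])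
        (specialise-eval (≡⇒ (φ-encode (specialise member k)) ev))) })
      (λ p → map₂ (≡⇐ (φ-encode (specialise member k)) ∘ eval-specialise)
        (search-complete (atomF (MEM !F v₀ ∷ v₁ ∷ [])) (k ∷ x ∷ []) (complete-MEM p)))

    W-self : ∀ x → W self x ⇔ (∃ λ σ → Relations (h (index x)) σ c × SpanUpTo (h (index x)) σ n)
    W-self x = mk⇔
      (λ { (y , ev) → subst (λ d → ∃ λ σ → Relations (h (index x)) σ d × SpanUpTo (h (index x)) σ n)
        (decV-encV c)
        (sound EVT (h (index x) ∷ l ∷ encV c ∷ [])
          (search-sound (atomF (EVT !F hF (encode-specialiseF member v₀) ∷ litF l ∷ litF (encV c) ∷ []))
            (x ∷ []) (≡⇒ (φ-encode event) ev))) })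
      (λ { (σ , r , s) → map₂ (≡⇐ (φ-encode event))
        (search-complete (atomF (EVT !F hF (encode-specialiseF member v₀) ∷ litF l ∷ litF (encV c) ∷ []))
          (x ∷ []) (complete-EVT σ c r s)) })

-- Exponent vectors and ordinals below ω^n

infixl 6 _⊕_
infix 4 _<lex_ _<O_ _≼_

_⊕_ : ∀ {n} → Vec ℕ n → Vec ℕ n → Vec ℕ n
_⊕_ = zipWith _+_

𝟘 : ∀ {n} → Vec ℕ n
𝟘 = replicate _ 0

⊕-identityʳ : ∀ {n} (u : Vec ℕ n) → u ⊕ 𝟘 ≡ u
⊕-identityʳ = zipWith-identityʳ +-identityʳ

⊕-assoc : ∀ {n} (u v w : Vec ℕ n) → (u ⊕ v) ⊕ w ≡ u ⊕ (v ⊕ w)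
⊕-assoc = zipWith-assoc +-assoc

⊕-comm : ∀ {n} (u v : Vec ℕ n) → u ⊕ v ≡ v ⊕ u
⊕-comm = zipWith-comm +-comm

data _<lex_ : ∀ {n} → Vec ℕ n → Vec ℕ n → Set where
  head< : ∀ {n x y} {u v : Vec ℕ n} → x < y → (x ∷ u) <lex (y ∷ v)
  tail< : ∀ {n x} {u v : Vec ℕ n} → u <lex v → (x ∷ u) <lex (x ∷ v)

⊕-monoˡ-<lex : ∀ {n} {u v : Vec ℕ n} w → u <lex v → u ⊕ w <lex v ⊕ w
⊕-monoˡ-<lex (z ∷ w) (head< p) = head< (+-monoˡ-< z p)
⊕-monoˡ-<lex (z ∷ w) (tail< p) = tail< (⊕-monoˡ-<lex w p)

⊕-monoʳ-<lex : ∀ {n} w {u v : Vec ℕ n} → u <lex v → w ⊕ u <lex w ⊕ v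
⊕-monoʳ-<lex w {u} {v} p = subst₂ _<lex_ (⊕-comm u w) (⊕-comm v w) (⊕-monoˡ-<lex w p)

mutual
  ∷-acc : ∀ {n x} {u : Vec ℕ n} → WellFounded (_<lex_ {n}) → Acc _<_ x → Acc _<lex_ u → Acc _<lex_ (x ∷ u)
  ∷-acc wf p q = acc (∷-below wf p q)

  ∷-below : ∀ {n x} {u : Vec ℕ n} → WellFounded (_<lex_ {n}) → Acc _<_ x → Acc _<lex_ u →
            ∀ {w} → w <lex x ∷ u → Acc _<lex_ w
  ∷-below wf (acc p) q       (head< y<x) = ∷-acc wf (p y<x) (wf _)
  ∷-below wf p       (acc q) (tail< v<u) = ∷-acc wf p (q v<u)

<lex-wellFounded : ∀ {n} → WellFounded (_<lex_ {n})
<lex-wellFounded {zero}  []      = acc λ ()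
<lex-wellFounded {suc n} (x ∷ u) = ∷-acc <lex-wellFounded (<-wellFounded x) (<lex-wellFounded u)

<lex-trichotomous : ∀ {n} (u v : Vec ℕ n) → u <lex v ⊎ u ≡ v ⊎ v <lex u
<lex-trichotomous [] [] = inj₂ (inj₁ refl)
<lex-trichotomous (x ∷ u) (y ∷ v) with <-cmp x y
... | tri< x<y _ _ = inj₁ (head< x<y)
... | tri> _ _ y<x = inj₂ (inj₂ (head< y<x))
... | tri≈ _ refl _ with <lex-trichotomous u v
...   | inj₁ p           = inj₁ (tail< p)
...   | inj₂ (inj₁ refl) = inj₂ (inj₁ refl)
...   | inj₂ (inj₂ p)    = inj₂ (inj₂ (tail< p))

data _<O_ {n : ℕ} : Ord n → Ord n → Set where
  fin<top : ∀ {v} → fin v <O top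
  fin<fin : ∀ {u v} → u <lex v → fin u <O fin v

<O-wellFounded : ∀ {n} → WellFounded (_<O_ {n})
<O-wellFounded = λ { top → acc (λ { fin<top → accFin (<lex-wellFounded _) })
                   ; (fin v) → accFin (<lex-wellFounded v) }
  where
  accFin : ∀ {n} {v : Vec ℕ n} → Acc _<lex_ v → Acc _<O_ (fin v)
  accFin (acc p) = acc λ { (fin<fin u<v) → accFin (p u<v) }

≤lex-refl : ∀ {n} {v : Vec ℕ n} → v ≤lex v
≤lex-refl {v = []}    = lex-[]
≤lex-refl {v = x ∷ v} = lex-≡ ≤lex-refl

≤lex-trans : ∀ {n} {u v w : Vec ℕ n} → u ≤lex v → v ≤lex w → u ≤lex w
≤lex-trans lex-[]    lex-[]    = lex-[]
≤lex-trans (lex-< p) (lex-< q) = lex-< (<-trans p q)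
≤lex-trans (lex-< p) (lex-≡ q) = lex-< p
≤lex-trans (lex-≡ p) (lex-< q) = lex-< q
≤lex-trans (lex-≡ p) (lex-≡ q) = lex-≡ (≤lex-trans p q)

<lex⇒≤lex : ∀ {n} {u v : Vec ℕ n} → u <lex v → u ≤lex v
<lex⇒≤lex (head< p) = lex-< p
<lex⇒≤lex (tail< p) = lex-≡ (<lex⇒≤lex p)

<lex⇒≱lex : ∀ {n} {u v : Vec ℕ n} → u <lex v → ¬ v ≤lex u
<lex⇒≱lex (head< p) (lex-< q) = <-asym p q
<lex⇒≱lex (head< p) (lex-≡ q) = <-irrefl refl p
<lex⇒≱lex (tail< p) (lex-< q) = <-irrefl refl q
<lex⇒≱lex (tail< p) (lex-≡ q) = <lex⇒≱lex p q

≤O-refl : ∀ {n} {o : Ord n} → o ≤O o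
≤O-refl {o = top}   = top≤top
≤O-refl {o = fin v} = fin≤fin ≤lex-refl

≤O-trans : ∀ {n} {o p q : Ord n} → o ≤O p → p ≤O q → o ≤O q
≤O-trans top≤top     q           = q
≤O-trans fin≤top     top≤top     = fin≤top
≤O-trans (fin≤fin p) fin≤top     = fin≤top
≤O-trans (fin≤fin p) (fin≤fin q) = fin≤fin (≤lex-trans p q)

<O⇒≤O : ∀ {n} {o p : Ord n} → o <O p → o ≤O p
<O⇒≤O fin<top     = fin≤top
<O⇒≤O (fin<fin p) = fin≤fin (<lex⇒≤lex p)

<O⇒≱O : ∀ {n} {o p : Ord n} → o <O p → ¬ p ≤O o
<O⇒≱O (fin<fin p) (fin≤fin q) = <lex⇒≱lex p q

_≼_ : ∀ {n} → Vec ℕ n → Vec ℕ n → Set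
u ≼ v = ∃ λ w → v ≡ u ⊕ w

_≼?_ : ∀ {n} (u v : Vec ℕ n) → Dec (u ≼ v)
[] ≼? [] = yes ([] , refl)
(x ∷ u) ≼? (y ∷ v) with x ≤? y | u ≼? v
... | yes x≤y | yes (w , eq) = yes (y ∸ x ∷ w , cong₂ _∷_ (sym (m+[n∸m]≡n x≤y)) eq)
... | no x≰y  | _            = no λ { (z ∷ w , refl) → x≰y (m≤m+n x z) }
... | yes _   | no u⋠v       = no λ { (z ∷ w , refl) → u⋠v (w , refl) }

-- Ranks of upward closed sets

Upset : ∀ {n} → (Vec ℕ n → Set) → Set
Upset U = ∀ u w → U u → U (u ⊕ w)

slice : ∀ {n} → (Vec ℕ (suc n) → Set) → Fin (suc n) → ℕ → Vec ℕ n → Set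
slice U i j x = U (insertAt x i j)

insertAt-⊕ : ∀ {n} (u w : Vec ℕ n) i j → insertAt u i j ⊕ insertAt w i 0 ≡ insertAt (u ⊕ w) i j
insertAt-⊕ u       w       zero    j = cong (_∷ u ⊕ w) (+-identityʳ j)
insertAt-⊕ (x ∷ u) (y ∷ w) (suc i) j = cong (x + y ∷_) (insertAt-⊕ u w i j)

slice-upset : ∀ {n} {U : Vec ℕ (suc n) → Set} → Upset U → ∀ i j → Upset (slice U i j)
slice-upset {U = U} up i j u w p = subst U (insertAt-⊕ u w i j) (up _ (insertAt w i 0) p)

-- The same ordinal written as a Cantor normal form below ω^(n+1); `top`, that is ω^n, gets leading
-- coefficient 1.
weight : ∀ {n} → Ord n → Vec ℕ (suc n)
weight top     = 1 ∷ 𝟘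
weight (fin v) = 0 ∷ v

weight-mono : ∀ {n} {o p : Ord n} → o <O p → weight o <lex weight p
weight-mono fin<top     = head< (s≤s z≤n)
weight-mono (fin<fin p) = tail< p

Slice : ℕ → Set
Slice n = Fin (suc n) × ℕ

_∈slice_ : ∀ {n} → Vec ℕ (suc n) → Slice n → Set
x ∈slice (i , j) = lookup x i ≡ j

-- Slices in the list may overlap or repeat, since v only has to be an upper bound.
RankSum : ∀ {n} → ((Vec ℕ n → Set) → Ord n → Set) → (Vec ℕ (suc n) → Set) →
          List (Slice n) → Vec ℕ (suc n) → Set
RankSum M U []            v = v ≡ 𝟘
RankSum M U ((i , j) ∷ L) v = ∃ λ o → ∃ λ w → M (slice U i j) o × RankSum M U L w × v ≡ weight o ⊕ w

-- Rank n U o bounds by o the rank of U among the upward closed sets containing it.  Only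
-- the finitely many slices covering the complement of U can still grow; their bounds (at most ω^(n-1))
-- are combined by the natural sum, which is the pointwise sum of Cantor normal forms.
Rank : ∀ n → (Vec ℕ n → Set) → Ord n → Set
Rank n       U top     = ⊤
Rank zero    U (fin v) = U v
Rank (suc n) U (fin v) = ∃ λ L → (∀ x → ¬ U x → Any (x ∈slice_) L) × RankSum (Rank n) U L v

RankSum-mono : ∀ {n} {M : (Vec ℕ n → Set) → Ord n → Set} →
  (∀ {U V} → (∀ {x} → U x → V x) → ∀ o → M U o → M V o) →
  ∀ {U V} → (∀ {x} → U x → V x) → ∀ L {v} → RankSum M U L v → RankSum M V L v
RankSum-mono M-mono U⊆V []            eq                   = eq
RankSum-mono M-mono U⊆V ((i , j) ∷ L) (o , w , r , s , eq) =
  o , w , M-mono U⊆V o r , RankSum-mono M-mono U⊆V L s , eq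

Rank-mono : ∀ n {U V : Vec ℕ n → Set} → (∀ {x} → U x → V x) → ∀ o → Rank n U o → Rank n V o
Rank-mono n       U⊆V top     r             = tt
Rank-mono zero    U⊆V (fin v) r             = U⊆V r
Rank-mono (suc n) U⊆V (fin v) (L , cov , s) =
  L , (λ x ¬Vx → cov x (λ Ux → ¬Vx (U⊆V Ux))) , RankSum-mono (Rank-mono n) U⊆V L s

-- These are the hyperplanes x_i = j with j < u_i; off all of them a vector lies in the cone above
-- u.
slices : ∀ {n} → Vec ℕ n → List (Fin n × ℕ)
slices []      = []
slices (a ∷ u) = List.map (zero ,_) (upTo a) ++ List.map (map₁ suc) (slices u)

slices-cover : ∀ {n} (u x : Vec ℕ n) → u ≼ x ⊎ Any (λ { (i , j) → lookup x i ≡ j }) (slices u)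
slices-cover []      []      = inj₁ ([] , refl)
slices-cover (a ∷ u) (y ∷ x) with a ≤? y | slices-cover u x
... | no a≰y  | _               = inj₂ (++⁺ˡ (map⁺ (∈-upTo⁺ (≰⇒> a≰y))))
... | yes _   | inj₂ p          = inj₂ (++⁺ʳ (List.map (zero ,_) (upTo a)) (map⁺ p))
... | yes a≤y | inj₁ (w , refl) = inj₁ (y ∸ a ∷ w , cong (_∷ u ⊕ w) (sym (m+[n∸m]≡n a≤y)))

RankSum-top : ∀ {n} (U : Vec ℕ (suc n) → Set) L → ∃ (RankSum (Rank n) U L)
RankSum-top U []            = 𝟘 , refl
RankSum-top U ((i , j) ∷ L) with RankSum-top U L
... | w , s = _ , top , w , tt , s , refl

module _ {n} (M : (Vec ℕ n → Set) → Ord n → Set)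
  (M-mono : ∀ {U V} → (∀ {x} → U x → V x) → ∀ o → M U o → M V o)
  (M-strict : ∀ {U V} → Upset U → Upset V → (∀ {x} → U x → V x) → ∀ {x} → V x → ¬ U x →
              ∀ o → M U o → ∃ λ p → p <O o × M V p) where

  -- The new point x lies outside U, hence in a listed slice. That slice grows strictly and its
  -- summand drops, the other summands remain valid bounds, and the natural sum is strictly monotone
  -- in each summand.
  RankSum-strict : ∀ {U V} → Upset U → Upset V → (∀ {x} → U x → V x) → ∀ {x} → V x → ¬ U x →
    ∀ L {v} → Any (x ∈slice_) L → RankSum M U L v → ∃ λ w → w <lex v × RankSum M V L w
  RankSum-strict {U} {V} upU upV U⊆V {x} Vx ¬Ux ((i , _) ∷ L) (here refl) (o , w , r , s , refl)
    with M-strict (slice-upset {U = U} upU i _) (slice-upset {U = V} upV i _) U⊆V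
           (subst V (sym (insertAt-removeAt x i)) Vx)
           (λ Ux → ¬Ux (subst U (insertAt-removeAt x i) Ux)) o r
  ... | p , p<o , r′ = _ , ⊕-monoˡ-<lex w (weight-mono p<o) ,
    p , w , r′ , RankSum-mono M-mono U⊆V L s , refl
  RankSum-strict upU upV U⊆V Vx ¬Ux (_ ∷ L) (there q) (o , w , r , s , refl)
    with RankSum-strict upU upV U⊆V Vx ¬Ux L q s
  ... | w′ , w′<w , s′ = _ , ⊕-monoʳ-<lex (weight o) w′<w , o , w′ , M-mono U⊆V o r , s′ , refl

-- Induction on the dimension. From the bound `top`: V contains the whole cone above x, so finitely
-- many slices cover the rest and their sum stays below ω^n. From a bound `fin v`: the old list of
-- slices still covers, and its sum drops.
Rank-strict : ∀ n {U V : Vec ℕ n → Set} → Upset U → Upset V → (∀ {x} → U x → V x) →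
              ∀ {x} → V x → ¬ U x → ∀ o → Rank n U o → ∃ λ p → p <O o × Rank n V p
Rank-strict zero upU upV U⊆V {[]} Vx ¬Ux top      r = fin [] , fin<top , Vx
Rank-strict zero upU upV U⊆V {[]} Vx ¬Ux (fin []) r = ⊥-elim (¬Ux r)
Rank-strict (suc n) {V = V} upU upV U⊆V {x} Vx ¬Ux top r with RankSum-top V (slices x)
... | v , s = fin v , fin<top , slices x , cov , s
  where
  cov : ∀ y → ¬ V y → Any (y ∈slice_) (slices x)
  cov y ¬Vy with slices-cover x y
  ... | inj₁ (w , refl) = ⊥-elim (¬Vy (upV x w Vx))
  ... | inj₂ p          = p
Rank-strict (suc n) {V = V} upU upV U⊆V {x} Vx ¬Ux (fin v) (L , cov , s)
  with RankSum-strict (Rank n) (Rank-mono n) (Rank-strict n) upU upV U⊆V Vx ¬Ux L (cov x ¬Ux) s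
... | w , w<v , s′ = fin w , fin<fin w<v , L , (λ y ¬Vy → cov y (λ Uy → ¬Vy (U⊆V Uy))) , s′

-- Congruences on ℕ^n

↑ : ∀ {n} → List (Vec ℕ n) → Vec ℕ n → Set
↑ B u = Any (_≼ u) B

↑-upset : ∀ {n} (B : List (Vec ℕ n)) → Upset (↑ B)
↑-upset B u w = Any.map (λ { {b} (z , refl) → z ⊕ w , ⊕-assoc b z w })

-- Adding to B an element of U that is not above B lowers the rank of `↑ B`, so this must stop. It
-- is undecidable whether such an element exists, hence the double negation.
dickson : ∀ {n} {U : Vec ℕ n → Set} → ¬ ¬ (∃ λ B → All U B × (∀ u → U u → ↑ B u))
dickson {n} {U} = go top (<O-wellFounded top) [] [] tt
  where
  go : ∀ o → Acc _<O_ o → ∀ B → All U B → Rank n (↑ B) o → ¬ ¬ (∃ λ B → All U B × (∀ u → U u → ↑ B u))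
  go o (acc below) B aB r none = none (B , aB , generated)
    where
    generated : ∀ u → U u → ↑ B u
    generated u Uu with any? (_≼? u) B
    ... | yes p = p
    ... | no ¬p with Rank-strict n (↑-upset B) (↑-upset (u ∷ B)) there (here (𝟘 , sym (⊕-identityʳ u))) ¬p o r
    ...   | p , p<o , r′ = ⊥-elim (go p (below p<o) (u ∷ B) (Uu ∷ aB) r′ none)

record IsCongruence {n} (R : Vec ℕ n → Vec ℕ n → Set) : Set where
  field
    reflR  : ∀ {u} → R u u
    symR   : ∀ {u v} → R u v → R v u
    transR : ∀ {u v w} → R u v → R v w → R u w
    shiftR : ∀ {u v} w → R u v → R (u ⊕ w) (v ⊕ w)

open IsCongruence

-- For a congruence R these are the exponents of the lexicographic initial ideal of the binomial
-- ideal of R.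
Lead : ∀ {n} → (Vec ℕ n → Vec ℕ n → Set) → Vec ℕ n → Set
Lead R u = ∃ λ v → v <lex u × R u v

Lead-upset : ∀ {n} {R : Vec ℕ n → Vec ℕ n → Set} → IsCongruence R → Upset (Lead R)
Lead-upset cR u w (v , v<u , r) = v ⊕ w , ⊕-monoˡ-<lex w v<u , shiftR cR w r

Holds : ∀ {n} → (Vec ℕ n → Vec ℕ n → Set) → Vec ℕ n × Vec ℕ n → Set
Holds R (u , v) = R u v

-- A pair of distinct normal forms would exhibit a leading exponent.
normal-forms-equal : ∀ {n} {R : Vec ℕ n → Vec ℕ n → Set} → IsCongruence R → ∀ {u v} → R u v →
                     ¬ Lead R u → ¬ Lead R v → u ≡ v
normal-forms-equal cR {u} {v} r ¬u ¬v with <lex-trichotomous u v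
... | inj₁ u<v        = ⊥-elim (¬v (u , u<v , symR cR r))
... | inj₂ (inj₁ eq)  = eq
... | inj₂ (inj₂ v<u) = ⊥-elim (¬u (v , v<u , r))

-- When B generates the leading exponents, this is a Gröbner basis: each pair rewrites a member of B
-- to something smaller in its class.
basis : ∀ {n} {R : Vec ℕ n → Vec ℕ n → Set} {B} → All (Lead R) B → List (Vec ℕ n × Vec ℕ n)
basis []                     = []
basis (_∷_ {u} (v , _) lead) = (u , v) ∷ basis lead

basis-holds : ∀ {n} {R : Vec ℕ n → Vec ℕ n → Set} {B} (lead : All (Lead R) B) → All (Holds R) (basis lead)
basis-holds []                     = []
basis-holds ((v , v<u , r) ∷ lead) = r ∷ basis-holds lead

module _ {n} {R S : Vec ℕ n → Vec ℕ n → Set} (cR : IsCongruence R) (cS : IsCongruence S) where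

  -- One rewriting step, by a basis pair shifted by w; it is valid in R and in S at once.
  reduce : ∀ {B} (lead : All (Lead R) B) → All (Holds S) (basis lead) →
           ∀ {u} → ↑ B u → ∃ λ v → v <lex u × R u v × S u v
  reduce ((v , v<b , r) ∷ lead) (s ∷ _)  (here (w , refl)) =
    v ⊕ w , ⊕-monoˡ-<lex w v<b , shiftR cR w r , shiftR cS w s
  reduce (_ ∷ lead)             (_ ∷ ss) (there p)         = reduce lead ss p

  -- Rewriting takes u and v to vectors that are least in their R-classes. As u and v are R-related,
  -- these coincide, and all steps taken hold in S too.
  basis-generates : ∀ {B} (lead : All (Lead R) B) → (∀ u → Lead R u → ↑ B u) →
                    All (Holds S) (basis lead) → ∀ {u v} → R u v → S u v
  basis-generates {B} lead spans ss {u} {v} r with nf u (<lex-wellFounded u) | nf v (<lex-wellFounded v)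
    where
    nf : ∀ u → Acc _<lex_ u → ∃ λ u′ → R u u′ × S u u′ × ¬ Lead R u′
    nf u (acc below) with any? (_≼? u) B
    ... | no ¬p = u , reflR cR , reflR cS , λ l → ¬p (spans u l)
    ... | yes p with reduce lead ss p
    ...   | v , v<u , r , s with nf v (below v<u)
    ...     | w , r′ , s′ , ¬w = w , transR cR r r′ , transR cS s s′ , ¬w
  ... | u′ , ru , su , ¬u | v′ , rv , sv , ¬v
    with normal-forms-equal cR (transR cR (symR cR ru) (transR cR r rv)) ¬u ¬v
  ...   | refl = transR cS su (symR cS sv)

-- Rédei's theorem: the Gröbner basis is finite by Dickson's lemma.
finitely-generated : ∀ {n} {R : Vec ℕ n → Vec ℕ n → Set} → IsCongruence R →
  ¬ ¬ (∃ λ L → All (Holds R) L ×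
        (∀ S → IsCongruence S → All (Holds S) L → ∀ {u v} → R u v → S u v))
finitely-generated cR none = dickson λ { (B , lead , spans) →
  none (basis lead , basis-holds lead , λ S cS → basis-generates cR cS lead spans) }

module _ {n} {R S : Vec ℕ n → Vec ℕ n → Set} (cR : IsCongruence R) (cS : IsCongruence S)
         (R⊆S : ∀ {u v} → R u v → S u v) where

  normal-form : ∀ u → Acc _<lex_ u → ¬ ¬ (∃ λ v → R u v × ¬ Lead R v)
  normal-form u (acc below) none = none (u , reflR cR , λ { (v , v<u , r) →
    normal-form v (below v<u) (λ { (w , r′ , ¬w) → none (w , transR cR r r′ , ¬w) }) })

  -- R-normal forms of u and v are S-normal as well, since S has no further leading exponents; being
  -- S-related, they are equal.
  equal-leads : ¬ (∃ λ u → Lead S u × ¬ Lead R u) → ∀ {u v} → S u v → ¬ ¬ R u v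
  equal-leads same {u} {v} s ¬r =
    normal-form u (<lex-wellFounded u) λ { (u′ , ru , ¬u) →
    normal-form v (<lex-wellFounded v) λ { (v′ , rv , ¬v) →
    ¬r (transR cR ru (symR cR (subst (R v)
      (sym (normal-forms-equal cS (transS (R⊆S ru) (R⊆S rv)) (λ l → same (u′ , l , ¬u))
                                                          (λ l → same (v′ , l , ¬v)))) rv))) } }
    where
    transS : ∀ {u′ v′} → S u u′ → S v v′ → S u′ v′
    transS p q = transR cS (symR cS p) (transR cS s q)

  -- `equal-leads` yields only a double negation for each pair, which cannot be moved past
  -- infinitely many pairs. A finite list generating S reduces the matter to a finite conjunction.
  new-lead : ¬ (∀ {u v} → S u v → R u v) → ¬ ¬ (∃ λ u → Lead S u × ¬ Lead R u)
  new-lead S⊈R same = finitely-generated cS λ { (L , holds , spans) →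
    all-¬¬ holds λ holdsR → S⊈R (spans R cR holdsR) }
    where
    all-¬¬ : ∀ {L} → All (Holds S) L → ¬ ¬ All (Holds R) L
    all-¬¬ []       k = k []
    all-¬¬ (s ∷ ss) k = equal-leads same s λ r → all-¬¬ ss λ rs → k (r ∷ rs)

-- Evaluation of exponent vectors

power : ∀ {n} → ℕ → Term n → Term n
power zero    t = ε
power (suc x) t = t · power x t

monomial : ∀ {n p} → (Fin n → Term p) → Vec ℕ n → Term p
monomial σ []      = ε
monomial σ (x ∷ u) = power x (σ zero) · monomial (σ ∘ suc) u

unit : ∀ {n} → Fin n → Vec ℕ n
unit zero    = 1 ∷ 𝟘
unit (suc i) = 0 ∷ unit i

exponents : ∀ {n} → Term n → Vec ℕ n
exponents (var i) = unit i
exponents ε       = 𝟘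
exponents (s · t) = exponents s ⊕ exponents t

sub-var : ∀ {n} (t : Term n) → sub var t ≡ t
sub-var (var i) = refl
sub-var ε       = refl
sub-var (s · t) = cong₂ _·_ (sub-var s) (sub-var t)

sub-power : ∀ {n p} (σ : Fin n → Term p) x t → sub σ (power x t) ≡ power x (sub σ t)
sub-power σ zero    t = refl
sub-power σ (suc x) t = cong (sub σ t ·_) (sub-power σ x t)

sub-monomial : ∀ {n p q} (σ : Fin p → Term q) (τ : Fin n → Term p) u →
               sub σ (monomial τ u) ≡ monomial (sub σ ∘ τ) u
sub-monomial σ τ []      = refl
sub-monomial σ τ (x ∷ u) = cong₂ _·_ (sub-power σ x (τ zero)) (sub-monomial σ (τ ∘ suc) u)

module _ {n e : ℕ} where
  private
    _~_ : Term n → Term n → Set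
    _~_ = Cong (Gen n e)

    medial : ∀ s t u v → ((s · t) · (u · v)) ~ ((s · u) · (t · v))
    medial = interchange (CommutativeMonoid.commutativeSemigroup (CM n e))

  power-+ : ∀ x y t → power (x + y) t ~ (power x t · power y t)
  power-+ zero    y t = ~sym idˡ
  power-+ (suc x) y t = ~trans (·-cong ~refl (power-+ x y t)) (~sym ~assoc)

  monomial-⊕ : ∀ {l} (σ : Fin l → Term n) u w → monomial σ (u ⊕ w) ~ (monomial σ u · monomial σ w)
  monomial-⊕ σ []      []      = ~sym idˡ
  monomial-⊕ σ (x ∷ u) (y ∷ w) =
    ~trans (·-cong (power-+ x y (σ zero)) (monomial-⊕ (σ ∘ suc) u w)) (medial _ _ _ _)

  monomial-𝟘 : ∀ {l} (σ : Fin l → Term n) → monomial σ 𝟘 ~ ε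
  monomial-𝟘 {zero}  σ = ~refl
  monomial-𝟘 {suc l} σ = ~trans idˡ (monomial-𝟘 (σ ∘ suc))

  monomial-unit : ∀ {l} (σ : Fin l → Term n) i → monomial σ (unit i) ~ σ i
  monomial-unit σ zero    = ~trans (·-cong idʳ (monomial-𝟘 (σ ∘ suc))) idʳ
  monomial-unit σ (suc i) = ~trans idˡ (monomial-unit (σ ∘ suc) i)

  sub-exponents : ∀ {l} (σ : Fin l → Term n) t → sub σ t ~ monomial σ (exponents t)
  sub-exponents σ (var i) = ~sym (monomial-unit σ i)
  sub-exponents σ ε       = ~sym (monomial-𝟘 σ)
  sub-exponents σ (s · t) = ~trans (·-cong (sub-exponents σ s) (sub-exponents σ t))
                                   (~sym (monomial-⊕ σ (exponents s) (exponents t)))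

-- Kernels of generating tuples

Ker : ∀ {n} → ℕ → (Fin n → Term n) → Vec ℕ n → Vec ℕ n → Set
Ker {n} e σ u v = Cong (Gen n e) (monomial σ u) (monomial σ v)

Ker-congruence : ∀ {n} e (σ : Fin n → Term n) → IsCongruence (Ker e σ)
Ker-congruence e σ = record
  { reflR  = ~refl
  ; symR   = ~sym
  ; transR = ~trans
  ; shiftR = λ {u} {v} w r → ~trans (monomial-⊕ σ u w)
      (~trans (·-cong r ~refl) (~sym (monomial-⊕ σ v w))) }

Onto : ∀ {n} → ℕ → (Fin n → Term n) → Set
Onto {n} e σ = ∀ t → ∃ λ u → Cong (Gen n e) (monomial σ u) t

onto-var : ∀ {n} e → Onto {n} e var
onto-var e t = exponents t , ~trans (~sym (sub-exponents var t)) (≡⇒~ (sub-var t))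

generators-onto : ∀ {n} e (σ : Fin n → Term n) →
                  (∀ i → ∃ λ w → Cong (Gen n e) (sub σ w) (var i)) → Onto e σ
generators-onto e σ gens (var i) with gens i
... | w , p = exponents w , ~trans (~sym (sub-exponents σ w)) p
generators-onto e σ gens ε = 𝟘 , monomial-𝟘 σ
generators-onto e σ gens (s · t) with generators-onto e σ gens s | generators-onto e σ gens t
... | u , p | w , q = u ⊕ w , ~trans (monomial-⊕ σ u w) (·-cong p q)

module _ {n e e′ : ℕ} (iso : ≅CM n e e′) where
  private
    f : Term n → Term n
    f = proj₁ iso

    open MonoidMorphisms.IsMonoidIsomorphism (proj₂ iso)

  map-power : ∀ x t → Cong (Gen n e′) (f (power x t)) (power x (f t))
  map-power zero    t = ε-homo
  map-power (suc x) t = ~trans (homo t (power x t)) (·-cong ~refl (map-power x t))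

  map-monomial : ∀ {l} (σ : Fin l → Term n) u → Cong (Gen n e′) (f (monomial σ u)) (monomial (f ∘ σ) u)
  map-monomial σ []      = ε-homo
  map-monomial σ (x ∷ u) = ~trans (homo _ _)
    (·-cong (map-power x (σ zero)) (map-monomial (σ ∘ suc) u))

  map-Ker : ∀ {σ u v} → Ker e σ u v → Ker e′ (f ∘ σ) u v
  map-Ker {σ} {u} {v} r = ~trans (~sym (map-monomial σ u)) (~trans (⟦⟧-cong r) (map-monomial σ v))

  map-Onto : ∀ {σ} → Onto e σ → Onto e′ (f ∘ σ)
  map-Onto {σ} onto t with surjective t
  ... | s , fs with onto s
  ...   | u , p = u , ~trans (~sym (map-monomial σ u)) (fs p)

-- Both monoids are the quotient of ℕ^n by the same congruence. The map chooses exponents for t over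
-- σ and evaluates them at σ′; one inclusion makes it well defined, the other injective.
Ker-iso : ∀ {n e e′} {σ σ′ : Fin n → Term n} → Onto e σ → Onto e′ σ′ →
          (∀ {u v} → Ker e σ u v → Ker e′ σ′ u v) → (∀ {u v} → Ker e′ σ′ u v → Ker e σ u v) → ≅CM n e e′
Ker-iso {n} {e} {e′} {σ} {σ′} onto onto′ ⊆₁ ⊆₂ = f , record
  { isMonoidMonomorphism = record
    { isMonoidHomomorphism = record
      { isMagmaHomomorphism = record
        { isRelHomomorphism = record { cong = λ {s} {t} p → ⊆₁ (~trans (lift-~ s) (~trans p (~sym (lift-~ t)))) }
        ; homo = λ s t → ~trans (⊆₁ (~trans (lift-~ (s · t)) (~trans (~sym (·-cong (lift-~ s) (lift-~ t)))
                                  (~sym (monomial-⊕ σ (lift s) (lift t))))))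
                                (monomial-⊕ σ′ (lift s) (lift t)) }
      ; ε-homo = ~trans (⊆₁ (~trans (lift-~ ε) (~sym (monomial-𝟘 σ)))) (monomial-𝟘 σ′) }
    ; injective = λ {s} {t} p → ~trans (~sym (lift-~ s)) (~trans (⊆₂ p) (lift-~ t)) }
  ; surjective = λ t → monomial σ (proj₁ (onto′ t)) , λ {z} p →
      ~trans (⊆₁ (~trans (lift-~ z) p)) (proj₂ (onto′ t)) }
  where
  lift : Term n → Vec ℕ n
  lift t = proj₁ (onto t)
  lift-~ : ∀ t → Cong (Gen n e) (monomial σ (lift t)) t
  lift-~ t = proj₂ (onto t)
  f : Term n → Term n
  f t = monomial σ′ (lift t)

-- Codes of ordinals

encodeVecOrd : ∀ {m} → Vec ℕ (suc m) → ℕ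
encodeVecOrd (x ∷ [])     = x
encodeVecOrd (x ∷ y ∷ xs) = pair x (encodeVecOrd (y ∷ xs))

decodeVec-encode : ∀ {m} (v : Vec ℕ (suc m)) → decodeVec m (encodeVecOrd v) ≡ v
decodeVec-encode (x ∷ [])     = refl
decodeVec-encode {suc m} (x ∷ y ∷ xs) = cong₂ _∷_ (π₁-pair x _)
  (trans (cong (decodeVec m) (π₂-pair x _)) (decodeVec-encode (y ∷ xs)))

decodeOrd-surjective : ∀ {m} (o : Ord (suc m)) → ∃ λ b → decodeOrd m b ≡ o
decodeOrd-surjective top     = 0 , refl
decodeOrd-surjective (fin v) = suc (encodeVecOrd v) , cong fin (decodeVec-encode v)

diverge : PR 1
diverge = mu (comp succ (proj zero ∷ []))

diverge-empty : Empty (encode diverge)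
diverge-empty x (y , ev) with ≡⇒ (φ-encode diverge) ev
... | ev-mu s = go s
  where
  go : ∀ {z y} → ¬ MuFrom (comp succ (proj zero ∷ [])) (x ∷ []) z y
  go (mu-here (ev-comp _ ()))
  go (mu-next _ s) = go s

-- The infinite descent

module Reduction (m : ℕ) (h : ℕ → ℕ) (comp-h : Computable h)
                 (reduces : ∀ x y → Emin m x y ⇔ ≅CM (suc m) (h x) (h y)) where

  n : ℕ
  n = suc m

  relation-code : Vec ℕ n × Vec ℕ n → ℕ
  relation-code (u , v) = pair (encodeTerm (monomial var u)) (encodeTerm (monomial var v))

  relation-codes : (L : List (Vec ℕ n × Vec ℕ n)) → Vec ℕ (length L)
  relation-codes []      = []
  relation-codes (p ∷ L) = relation-code p ∷ relation-codes L

  module _ (D : Maybe ℕ) (b : ℕ) where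
    open System m D b using (Relations)

    code-monomial : ∀ (σ : Fin n → Term n) c u → c ≡ encodeTerm (monomial var u) →
                    sub σ (termOf n c) ≡ monomial σ u
    code-monomial σ _ u refl = trans (cong (sub σ) (termOf-encodeTerm m (monomial var u))) (sub-monomial σ var u)

    Relations⇔Holds : ∀ e σ L → Relations e σ (relation-codes L) ⇔ All (Holds (Ker e σ)) L
    Relations⇔Holds e σ L = mk⇔ (⇒ L) (⇐ L)
      where
      eq₁ : ∀ u v → sub σ (termOf n (π₁ (relation-code (u , v)))) ≡ monomial σ u
      eq₁ u v = code-monomial σ _ u (π₁-pair _ _)
      eq₂ : ∀ u v → sub σ (termOf n (π₂ (relation-code (u , v)))) ≡ monomial σ v
      eq₂ u v = code-monomial σ _ v (π₂-pair (encodeTerm (monomial var u)) _)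
      ⇒ : ∀ L → Relations e σ (relation-codes L) → All (Holds (Ker e σ)) L
      ⇒ []            []       = []
      ⇒ ((u , v) ∷ L) (r ∷ rs) = ~trans (≡⇒~ (sym (eq₁ u v))) (~trans r (≡⇒~ (eq₂ u v))) ∷ ⇒ L rs
      ⇐ : ∀ L → All (Holds (Ker e σ)) L → Relations e σ (relation-codes L)
      ⇐ []            []       = []
      ⇐ ((u , v) ∷ L) (r ∷ rs) = ~trans (≡⇒~ (eq₁ u v)) (~trans r (≡⇒~ (sym (eq₂ u v)))) ∷ ⇐ L rs

  KerRank : ℕ → (Fin n → Term n) → Ord n → Set
  KerRank e σ = Rank n (Lead (Ker (h e) σ))

  -- D is to be the least element of `W e`, or `nothing` if that set is empty. `included` refutes
  -- the case in which `self` rejects itself; `excluded` makes the quotient proper when it accepts.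
  descend : ∀ e σ o (D : Maybe ℕ) b → Onto (h e) σ → KerRank e σ o →
    (∀ e′ → (∀ x → W e′ x ⇔ D ≡ just x) → Emin m e e′) →
    (∀ e′ → (∀ x → W e′ x ⇔ (D ≡ just x ⊎ x ≡ b)) → ¬ Emin m e e′) →
    ¬ ¬ (∃ λ e′ → ∃ λ σ′ → ∃ λ p → (∀ x → W e′ x ⇔ (D ≡ just x ⊎ x ≡ b)) ×
         Onto (h e′) σ′ × p <O o × KerRank e′ σ′ p)
  descend e σ o D b onto rank included excluded none =
    -- A program can test only finitely many relations, so a finite presentation is fixed before the
    -- diagonal program is built.
    finitely-generated (Ker-congruence (h e) σ) λ { (L , holds , generates) → diagonalise L holds generates }
    where
    open System m D b using (SpanUpTo)

    diagonalise : ∀ L → All (Holds (Ker (h e) σ)) L →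
      (∀ S → IsCongruence S → All (Holds S) L → ∀ {u v} → Ker (h e) σ u v → S u v) → ⊥
    diagonalise L holds generates = not-accepted accepted
      where
      open Diagonal m D b h comp-h (relation-codes L)

      e′ : ℕ
      e′ = index self

      not-accepted : ¬ ¬ W self self
      not-accepted ¬w = ¬w (from (W-self self) (σ′ ,
        from (Relations⇔Holds D b (h e′) σ′ L) (All.map (λ { {u , v} → map-Ker iso {σ} {u} {v} }) holds) , span))
        where
        iso : ≅CM n (h e) (h e′)
        iso = to (reduces e e′) (included e′ λ x → mk⇔
          (λ w → fromD (to (W-index self x) w)) (λ d → from (W-index self x) (inj₁ d)))
          where
          fromD : ∀ {x} → D ≡ just x ⊎ (x ≡ b × W self self) → D ≡ just x
          fromD (inj₁ d)       = d
          fromD (inj₂ (_ , w)) = ⊥-elim (¬w w)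
        σ′ : Fin n → Term n
        σ′ = proj₁ iso ∘ σ
        span : SpanUpTo (h e′) σ′ n
        span i _ with map-Onto iso onto (var i)
        ... | u , p = monomial var u , ~trans (≡⇒~ (sub-monomial σ′ var u)) p

      accepted : ¬ W self self
      accepted w with to (W-self self) w
      ... | σ′ , rels , span = new-lead (Ker-congruence (h e) σ) (Ker-congruence (h e′) σ′) R⊆S S⊈R
        λ { (u , lead , ¬lead) → let p , p<o , rank′ = Rank-strict n
                                       (Lead-upset (Ker-congruence (h e) σ)) (Lead-upset (Ker-congruence (h e′) σ′))
                                       (λ { (v , v<u , r) → v , v<u , R⊆S r }) lead ¬lead o rank
                                 in none (e′ , σ′ , p , W-e′ , onto′ , p<o , rank′) }
        where
        W-e′ : ∀ x → W e′ x ⇔ (D ≡ just x ⊎ x ≡ b)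
        W-e′ x = mk⇔ (map-⊎ ∘ to (W-index self x)) (from (W-index self x) ∘ unmap-⊎)
          where
          map-⊎ : D ≡ just x ⊎ (x ≡ b × W self self) → D ≡ just x ⊎ x ≡ b
          map-⊎ (inj₁ d)       = inj₁ d
          map-⊎ (inj₂ (q , _)) = inj₂ q
          unmap-⊎ : D ≡ just x ⊎ x ≡ b → D ≡ just x ⊎ (x ≡ b × W self self)
          unmap-⊎ (inj₁ d) = inj₁ d
          unmap-⊎ (inj₂ q) = inj₂ (q , w)
        onto′ : Onto (h e′) σ′
        onto′ = generators-onto (h e′) σ′ (λ i → span i (toℕ<n i))
        R⊆S : ∀ {u v} → Ker (h e) σ u v → Ker (h e′) σ′ u v
        R⊆S = generates _ (Ker-congruence (h e′) σ′) (to (Relations⇔Holds D b (h e′) σ′ L) rels)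
        -- Equal kernels would give isomorphic monoids, and the reduction would then identify e with
        -- e′.
        S⊈R : ¬ (∀ {u v} → Ker (h e′) σ′ u v → Ker (h e) σ u v)
        S⊈R S⊆R = excluded e′ W-e′ (from (reduces e e′) (Ker-iso onto onto′ R⊆S S⊆R))

  -- If the rank bound o were below the least element, enumerating o itself would make o the least
  -- element and push the bound to some p below o: the same situation again, at a smaller ordinal.
  least-≤-rank : ∀ o → Acc _<O_ o → ∀ e y σ → IsLeast m e y → Onto (h e) σ → KerRank e σ o →
                 ¬ (o <O decodeOrd m y)
  least-≤-rank o (acc below) e y σ least@(Wy , y≤) onto rank o<y with decodeOrd-surjective o
  ... | b , refl = descend e σ o (just y) b onto rank included excluded
    λ { (e′ , σ′ , p , W-e′ , onto′ , p<o , rank′) →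
      least-≤-rank p (below p<o) e′ b σ′ (least′ W-e′) onto′ rank′ p<o }
    where
    included : ∀ e′ → (∀ x → W e′ x ⇔ just y ≡ just x) → Emin m e e′
    included e′ W-e′ = inj₂ (y , least , from (W-e′ y) refl , λ z w → ≤-y (to (W-e′ z) w))
      where
      ≤-y : ∀ {z} → just y ≡ just z → y ≤[ m ] z
      ≤-y refl = ≤O-refl
    excluded : ∀ e′ → (∀ x → W e′ x ⇔ (just y ≡ just x ⊎ x ≡ b)) → ¬ Emin m e e′
    excluded e′ W-e′ (inj₁ (empty , _)) = empty y Wy
    excluded e′ W-e′ (inj₂ (z , (Wz , _) , (_ , z≤))) =
      -- A common least element z would satisfy y ≤ z ≤ b, against b < y.
      <O⇒≱O o<y (≤O-trans (y≤ z Wz) (z≤ b (from (W-e′ b) (inj₂ refl))))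
    least′ : ∀ {e′} → (∀ x → W e′ x ⇔ (just y ≡ just x ⊎ x ≡ b)) → IsLeast m e′ b
    least′ W-e′ = from (W-e′ b) (inj₂ refl) , λ z w → b≤ (to (W-e′ z) w)
      where
      b≤ : ∀ {z} → just y ≡ just z ⊎ z ≡ b → b ≤[ m ] z
      b≤ (inj₁ refl) = <O⇒≤O o<y
      b≤ (inj₂ refl) = ≤O-refl

  -- The number 0 codes ω^n, and the bound `top` holds for any kernel. Enumerating ω^n into the
  -- empty set makes it the least element while the rank falls below it; this first move is what the
  -- summand 1 in ω^n + 1 provides.
  contradiction : ⊥
  contradiction = descend (encode diverge) var top nothing 0 (onto-var _) tt
    (λ e′ W-e′ → inj₁ (diverge-empty , λ x w → nothing≢just (to (W-e′ x) w)))
    (λ e′ W-e′ → λ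
      { (inj₁ (_ , empty)) → empty 0 (from (W-e′ 0) (inj₂ refl))
      ; (inj₂ (y , (w , _) , _)) → diverge-empty y w })
    λ { (e′ , σ′ , p , W-e′ , onto′ , p<top , rank′) →
      least-≤-rank p (<O-wellFounded p) e′ 0 σ′
        (from (W-e′ 0) (inj₂ refl) , λ z w → 0≤ (to (W-e′ z) w)) onto′ rank′ p<top }
    where
    nothing≢just : ∀ {x : ℕ} → nothing ≡ just x → ⊥
    nothing≢just ()
    0≤ : ∀ {z} → nothing ≡ just z ⊎ z ≡ 0 → 0 ≤[ m ] z
    0≤ (inj₂ refl) = ≤O-refl

theorem4p11 : (m : ℕ) → ¬ (Emin m ≤c ≅CM (suc m))
theorem4p11 m (h , comp-h , reduces) = Reduction.contradiction m h comp-h reduces
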